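{- Let $q$ be a power of the prime $p$ and $n$ a positive integer. Let $h\in \mathbb{F}_q[x]$ and $f, k\in\mathbb{F}_{q^n}[x]$ with $k(\mathbb{F}_q)\subseteq \mathbb{F}_q^*$, and let $P(x)=f(\mathrm{Tr}_{q^n/q}(x))+k(\mathrm{Tr}_{q^n/q}(x))\cdot L_h(x)$. Then $P$ is a permutation polynomial of $\mathbb{F}_{q^n}$ if and only if: (1) $\gcd\left(h(x), \frac{x^n-1}{x-1}\right)=1$; and (2) $Q(x):=T_n[f](x)+k(x)\cdot h(1)\cdot x$ induces a permutation of $\mathbb{F}_q$. Moreover, in this case, if $R\in\mathbb{F}_q[x]$ induces the inverse permutation of $Q$ on $\mathbb{F}_q$, then the inverse of the permutation of $\mathbb{F}_{q^n}$ induced by $P$ is induced by $$P_0(x)=F(\mathrm{Tr}_{q^n/q}(x))+k(R(\mathrm{Tr}_{q^n/q}(x)))^{q-2}\cdot L_H(x),$$ where $H\in \mathbb{F}_q[x]$ and $F\in \mathbb{F}_{q^n}[x]$ are as follows: (i) if $p\mid n$: $H$ is the unique polynomial of degree at most $n-1$ with $h(x)H(x)\equiv 1\pmod{x^n-1}$ (such $H$ exists, since when $p\mid n$ condition (1) is equivalent to $\gcd(h(x),x^n-1)=1$), and $F$ is any polynomial with $F(x)\equiv -k(R(x))^{q-2}\cdot L_H(f(R(x)))\pmod{x^q-x}$; (ii) if $p\nmid n$: $H$ is the unique polynomial of degree at most $n-2$ with $h(x)H(x)\equiv 1\pmod{\frac{x^n-1}{x-1}}$, and $F$ is any polynomial with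 $F(x)\equiv M(R(x))\pmod{x^q-x}$, where $M(x)=-k(x)^{q-2}\cdot L_H(f(x))+x\cdot\frac{1-h(1)H(1)}{n}$.
   Context: For $u(x)=\sum_{i=0}^m a_i x^i\in\mathbb{F}_q[x]$, its linearized $q$-associate is $L_u(x)=\sum_{i=0}^m a_i x^{q^i}$. $\mathrm{Tr}_{q^n/q}(x)=x+x^q+\cdots+x^{q^{n-1}}$ is the trace polynomial. For $f(x)=\sum_{i=0}^d a_i x^i\in\mathbb{F}_{q^n}[x]$, define $T_n[f](x)=\sum_{i=0}^d \mathrm{Tr}_{q^n/q}(a_i)x^i\in\mathbb{F}_q[x]$. A permutation polynomial of a finite field is a polynomial inducing a bijection of it. -}

module Defs where

open import Algebra.Bundles using (CommutativeRing)
open import Algebra.Bundles.Raw using (RawRing)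
open import Algebra.Core using (Op₁)
open import Algebra.Morphism.Structures using (module RingMorphisms)
import Algebra.Definitions.RawSemiring as RawSemiringDefinitions
import Algebra.Properties.Ring as RingProperties
open import Data.Fin.Base using (Fin; toℕ)
import Data.Fin.Properties as Fin
open import Data.List.Base using (List; []; _∷_; foldr; length; lookup; map; replicate)
open import Data.Nat.Base as ℕ using (ℕ; zero; suc)
open import Data.Product.Base using (∃; _×_)
open import Function.Bundles using (Inverse)
open import Function.Definitions using (Bijective; Inverseᵇ)
open import Level using (Level; _⊔_) renaming (suc to lsuc)
import Relation.Binary.Reasoning.Setoid as SetoidReasoning

-- A field with exactly m elements.  The value 0# ⁻¹ is unconstrained.

record FiniteField c ℓ (m : ℕ) : Set (lsuc (c ⊔ ℓ)) where
  field
    commutativeRing : CommutativeRing c ℓ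

  open CommutativeRing commutativeRing public

  infix 9 _⁻¹

  field
    1≉0         : 1# ≉ 0#
    _⁻¹         : Op₁ Carrier
    ⁻¹-cong     : ∀ {x y} → x ≈ y → x ⁻¹ ≈ y ⁻¹
    *-inverseʳ  : ∀ x → x ≉ 0# → x * x ⁻¹ ≈ 1#
    enumeration : Inverse (Fin.≡-setoid m) setoid

  open RawSemiringDefinitions (RawRing.rawSemiring rawRing) public
    using () renaming (_×_ to _·_)

-- Polynomials in one variable are lists of coefficients, constant term first,
-- identified when they agree up to trailing zeros.

module Polynomial {c ℓ} (R : CommutativeRing c ℓ) where

  open CommutativeRing R

  Poly : Set c
  Poly = List Carrier

  coeff : Poly → ℕ → Carrier
  coeff []      _       = 0#
  coeff (a ∷ _) zero    = a
  coeff (_ ∷ u) (suc i) = coeff u i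

  infix 4 _≈ₚ_

  record _≈ₚ_ (u v : Poly) : Set ℓ where
    constructor coeffwise
    field
      coeff-≈ : ∀ i → coeff u i ≈ coeff v i

  open _≈ₚ_ public

  infixl 6 _+ₚ_ _-ₚ_
  infixl 7 _*ₚ_
  infix  8 -ₚ_

  C : Carrier → Poly
  C a = a ∷ []

  0ₚ 1ₚ X : Poly
  0ₚ = []
  1ₚ = C 1#
  X  = 0# ∷ 1# ∷ []

  _+ₚ_ : Poly → Poly → Poly
  []      +ₚ v       = v
  u       +ₚ []      = u
  (a ∷ u) +ₚ (b ∷ v) = a + b ∷ u +ₚ v

  -ₚ_ : Poly → Poly
  -ₚ_ = map (-_)

  _-ₚ_ : Poly → Poly → Poly
  u -ₚ v = u +ₚ -ₚ v

  _*ₚ_ : Poly → Poly → Poly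
  []      *ₚ _ = []
  (a ∷ u) *ₚ v = map (a *_) v +ₚ (0# ∷ u *ₚ v)

  polyRawRing : RawRing c ℓ
  polyRawRing = record
    { Carrier = Poly
    ; _≈_     = _≈ₚ_
    ; _+_     = _+ₚ_
    ; _*_     = _*ₚ_
    ; -_      = -ₚ_
    ; 0#      = 0ₚ
    ; 1#      = 1ₚ
    }

  open RawSemiringDefinitions (RawRing.rawSemiring polyRawRing) public
    using ()
    renaming (_^_ to _^ₚ_; _∣_ to _∣ₚ_; Coprime to Coprimeₚ; sum to sumₚ)

  eval : Poly → Carrier → Carrier
  eval u x = foldr (λ a y → a + x * y) 0# u

  infixr 9 _∘ₚ_

  _∘ₚ_ : Poly → Poly → Poly
  u ∘ₚ v = foldr (λ a w → C a +ₚ v *ₚ w) 0ₚ u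

  infix 4 _≅_[modₚ_]

  _≅_[modₚ_] : Poly → Poly → Poly → Set (c ⊔ ℓ)
  u ≅ v [modₚ m ] = m ∣ₚ u -ₚ v

  -- The degree of u is less than d; only the zero polynomial has degree less
  -- than 0.
  DegreeBelow : ℕ → Poly → Set ℓ
  DegreeBelow d u = ∀ i → d ℕ.≤ i → coeff u i ≈ 0#

  ReducedInverse : Poly → Poly → ℕ → Poly → Set (c ⊔ ℓ)
  ReducedInverse h m d H = DegreeBelow d H × (h *ₚ H ≅ 1ₚ [modₚ m ])

  IsPermutationPolynomial : Poly → Set (c ⊔ ℓ)
  IsPermutationPolynomial u = Bijective _≈_ _≈_ (eval u)

  linearizedAssociate : ℕ → Poly → Poly
  linearizedAssociate q u =
    sumₚ (λ (i : Fin (length u)) → C (lookup u i) *ₚ X ^ₚ (q ℕ.^ toℕ i))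

  tracePoly : ℕ → ℕ → Poly
  tracePoly q n = sumₚ (λ (i : Fin n) → X ^ₚ (q ℕ.^ toℕ i))

  -- The polynomial (xⁿ - 1)/(x - 1), written out as 1 + x + ⋯ + xⁿ⁻¹.
  [Xⁿ-1]/[X-1] : ℕ → Poly
  [Xⁿ-1]/[X-1] n = replicate n 1#

  private
    open SetoidReasoning setoid
    open RingProperties ring using (-1*x≈-x; -0#≈0#)

    coeff-+ : ∀ u v i → coeff (u +ₚ v) i ≈ coeff u i + coeff v i
    coeff-+ []      v       i       = sym (+-identityˡ _)
    coeff-+ (a ∷ u) []      i       = sym (+-identityʳ _)
    coeff-+ (a ∷ u) (b ∷ v) zero    = refl
    coeff-+ (a ∷ u) (b ∷ v) (suc i) = coeff-+ u v i

    coeff-scale : ∀ a u i → coeff (map (a *_) u) i ≈ a * coeff u i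
    coeff-scale a []      i       = sym (zeroʳ a)
    coeff-scale a (b ∷ u) zero    = refl
    coeff-scale a (b ∷ u) (suc i) = coeff-scale a u i


    coeff-[a+X]* : ∀ a u i →
      coeff ((a ∷ 1# ∷ []) *ₚ u) i ≈ a * coeff u i + coeff (0# ∷ u) i
    coeff-[a+X]* a u i = begin
      coeff (map (a *_) u +ₚ (0# ∷ (C 1# *ₚ u))) i
        ≈⟨ coeff-+ (map (a *_) u) _ i ⟩
      coeff (map (a *_) u) i + coeff (0# ∷ (C 1# *ₚ u)) i
        ≈⟨ +-cong (coeff-scale a u i) (tail i) ⟩
      a * coeff u i + coeff (0# ∷ u) i ∎
      where
      zeros : ∀ j → coeff (0# ∷ []) j ≈ 0#
      zeros zero    = refl
      zeros (suc j) = refl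

      tail : ∀ j → coeff (0# ∷ (C 1# *ₚ u)) j ≈ coeff (0# ∷ u) j
      tail zero    = refl
      tail (suc j) = begin
        coeff (map (1# *_) u +ₚ (0# ∷ [])) j ≈⟨ coeff-+ (map (1# *_) u) _ j ⟩
        coeff (map (1# *_) u) j + coeff (0# ∷ []) j
          ≈⟨ +-cong (trans (coeff-scale 1# u j) (*-identityˡ _)) (zeros j) ⟩
        coeff u j + 0#                       ≈⟨ +-identityʳ _ ⟩
        coeff u j                            ∎

    coeff-X* : ∀ u i → coeff (X *ₚ u) i ≈ coeff (0# ∷ u) i
    coeff-X* u i = begin
      coeff (X *ₚ u) i                   ≈⟨ coeff-[a+X]* 0# u i ⟩
      0# * coeff u i + coeff (0# ∷ u) i ≈⟨ +-congʳ (zeroˡ _) ⟩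
      0# + coeff (0# ∷ u) i             ≈⟨ +-identityˡ _ ⟩
      coeff (0# ∷ u) i                  ∎

    telescope : ∀ n i →
      - coeff ([Xⁿ-1]/[X-1] n) i + coeff (0# ∷ [Xⁿ-1]/[X-1] n) i
        ≈ coeff (X ^ₚ n) i + coeff (-ₚ 1ₚ) i
    telescope zero    zero    = begin
      - 0# + 0#   ≈⟨ +-congʳ -0#≈0# ⟩
      0# + 0#     ≈⟨ +-identityʳ 0# ⟩
      0#          ≈⟨ sym (-‿inverseʳ 1#) ⟩
      1# - 1#     ∎
    telescope zero    (suc i) = +-congʳ -0#≈0#
    telescope (suc n) zero    = begin
      - 1# + 0#                    ≈⟨ +-comm _ _ ⟩
      0# - 1#                      ≈⟨ +-congʳ (sym (coeff-X* (X ^ₚ n) 0)) ⟩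
      coeff (X ^ₚ suc n) 0 - 1#    ∎
    telescope (suc n) (suc i) = begin
      - g i + coeff (1# ∷ [Xⁿ-1]/[X-1] n) i          ≈⟨ step i ⟩
      coeff (X ^ₚ n) i                               ≈⟨ sym (coeff-X* (X ^ₚ n) (suc i)) ⟩
      coeff (X ^ₚ suc n) (suc i)                     ≈⟨ sym (+-identityʳ _) ⟩
      coeff (X ^ₚ suc n) (suc i) + 0#                ∎
      where
      g = coeff ([Xⁿ-1]/[X-1] n)

      step : ∀ j → - g j + coeff (1# ∷ [Xⁿ-1]/[X-1] n) j ≈ coeff (X ^ₚ n) j
      step zero = begin
        - g 0 + 1#                          ≈⟨ +-congʳ (sym (+-identityʳ _)) ⟩
        (- g 0 + 0#) + 1#                   ≈⟨ +-congʳ (telescope n 0) ⟩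
        (coeff (X ^ₚ n) 0 - 1#) + 1#        ≈⟨ +-assoc _ _ _ ⟩
        coeff (X ^ₚ n) 0 + (- 1# + 1#)      ≈⟨ +-congˡ (-‿inverseˡ 1#) ⟩
        coeff (X ^ₚ n) 0 + 0#               ≈⟨ +-identityʳ _ ⟩
        coeff (X ^ₚ n) 0                    ∎
      step (suc j) = trans (telescope n (suc j)) (+-identityʳ _)

  [X-1]*[Xⁿ-1]/[X-1] : ∀ n →
    (X -ₚ 1ₚ) *ₚ [Xⁿ-1]/[X-1] n ≈ₚ X ^ₚ n -ₚ 1ₚ
  [X-1]*[Xⁿ-1]/[X-1] n = coeffwise λ i → begin
    coeff ((X -ₚ 1ₚ) *ₚ [Xⁿ-1]/[X-1] n) i
      ≈⟨ coeff-[a+X]* (0# - 1#) ([Xⁿ-1]/[X-1] n) i ⟩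
    (0# - 1#) * g i + coeff (0# ∷ [Xⁿ-1]/[X-1] n) i
      ≈⟨ +-congʳ (trans (*-congʳ (+-identityˡ (- 1#))) (-1*x≈-x (g i))) ⟩
    - g i + coeff (0# ∷ [Xⁿ-1]/[X-1] n) i
      ≈⟨ telescope n i ⟩
    coeff (X ^ₚ n) i + coeff (-ₚ 1ₚ) i
      ≈⟨ sym (coeff-+ (X ^ₚ n) (-ₚ 1ₚ) i) ⟩
    coeff (X ^ₚ n -ₚ 1ₚ) i ∎
    where g = coeff ([Xⁿ-1]/[X-1] n)

-- The inclusion 𝔽_q ⊆ 𝔽_{qⁿ} is an injective ring homomorphism ι : F → K, so
-- 𝔽_q as a subset of K is the image of ι.

module Extension
  {c₁ ℓ₁ c₂ ℓ₂ : Level} (q n : ℕ)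
  (F : FiniteField c₁ ℓ₁ q) (K : FiniteField c₂ ℓ₂ (q ℕ.^ n))
  (ι : FiniteField.Carrier F → FiniteField.Carrier K)
  where

  private
    module F = FiniteField F
    module K = FiniteField K
    module F[x] = Polynomial F.commutativeRing

  open Polynomial K.commutativeRing

  IsInclusion : Set (c₁ ⊔ ℓ₁ ⊔ ℓ₂)
  IsInclusion = RingMorphisms.IsRingMonomorphism F.rawRing K.rawRing ι

  embed : F[x].Poly → Poly
  embed = map ι

  Tr : Poly
  Tr = tracePoly q n

  -- The coefficients of T u lie in 𝔽_q, but T u is kept as a polynomial over K.
  T : Poly → Poly
  T = map (eval Tr)

  L : F[x].Poly → Poly
  L u = linearizedAssociate q (embed u)

  MapsBaseToUnits : Poly → Set (c₁ ⊔ ℓ₁ ⊔ ℓ₂)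
  MapsBaseToUnits u = ∀ a → ∃ λ b → b F.≉ F.0# × eval u (ι a) K.≈ ι b

  InducesOnBase : Poly → (F.Carrier → F.Carrier) → Set (c₁ ⊔ ℓ₂)
  InducesOnBase u σ = ∀ a → eval u (ι a) K.≈ ι (σ a)

  PermutesBase : Poly → Set (c₁ ⊔ ℓ₁ ⊔ ℓ₂)
  PermutesBase u = ∃ λ σ → InducesOnBase u σ × Bijective F._≈_ F._≈_ σ

  InducesInverseOnBase : F[x].Poly → Poly → Set (c₁ ⊔ ℓ₁ ⊔ ℓ₂)
  InducesInverseOnBase r u =
    ∃ λ σ → InducesOnBase u σ × Inverseᵇ F._≈_ F._≈_ σ (F[x].eval r)

  InducesInverse : Poly → Poly → Set (c₂ ⊔ ℓ₂)
  InducesInverse v u = Inverseᵇ K._≈_ K._≈_ (eval u) (eval v)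

{-# OPTIONS --safe #-}

-- The q-associates act on K as the polynomials in the Frobenius map φ, and φⁿ = 1 makes ℒ u depend
-- only on u modulo xⁿ - 1; by root counting no nonzero u of degree below n acts as zero.  The trace
-- is ℒ E with E = (xⁿ - 1)/(x - 1), so Tr ∘ P = Q ∘ Tr: the map P permutes K exactly when Q permutes
-- 𝔽_q and ker (ℒ h) meets ker Tr trivially, and the latter is coprimality of h and E.  On a fibre of
-- Tr the map P is affine in ℒ h, and it is inverted with the help of ℒ H (ℒ h x) = x when h H ≡ 1
-- modulo xⁿ - 1, and ℒ H (ℒ h x) = x + w(1) Tr x when h H = 1 + w E.

module Submission where

open import Defs
open import Algebra.Bundles using (CommutativeMonoid; CommutativeRing)
import Algebra.Construct.Pointwise as Pointwise
open import Algebra.Definitions.RawMagma using (module _∣ʳ_; _,_)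
import Algebra.Morphism.GroupMonomorphism as GroupMonomorphism
open import Algebra.Morphism.Structures using (module RingMorphisms)
import Algebra.Properties.CommutativeMonoid.Sum as CommutativeMonoidSum
import Algebra.Properties.CommutativeSemigroup as CommutativeSemigroupProperties
import Algebra.Properties.CommutativeSemiring.Binomial as Binomial
import Algebra.Properties.CommutativeSemiring.Exp as CommutativeExp
import Algebra.Properties.Group as GroupProperties
import Algebra.Properties.Ring as RingProperties
import Algebra.Properties.Semiring.Exp as Exp
import Algebra.Properties.Semiring.Mult as Mult
import Algebra.Properties.Semiring.Sum as Sum
import Algebra.Solver.Ring.NaturalCoefficients.Default as SemiringSolver
open import Algebra.Structures using (IsAbelianGroup)
open import Data.Fin.Base using (Fin; zero; suc; toℕ; fromℕ; inject₁; punchIn)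
import Data.Fin.Permutation as Permutation
import Data.Fin.Properties as Fin
open import Data.List.Base using ([]; _∷_; length; lookup; map; replicate)
open import Data.Nat.Base as ℕ using (ℕ; zero; suc; _≤_; _∸_; z≤n; s≤s; _!)
open import Data.Nat.Combinatorics using (_C_; nCk≡n!/k![n-k]!; k![n∸k]!∣n!; nCn≡1)
open import Data.Nat.Coprimality using (Coprime; coprime-Bézout)
open import Data.Nat.Divisibility using (_∣_; _∤_; divides; ∣⇒≤; ∣1⇒≡1; m∣m*n)
import Data.Nat.DivMod as ℕ
open import Data.Nat.GCD using (module Bézout)
open import Data.Nat.Primality
  using (Prime; euclidsLemma; prime⇒irreducible; prime⇒nonTrivial; prime⇒nonZero)
import Data.Nat.Properties as ℕ
open import Data.Product using (∃; ∃₂; ∃!; _×_; _,_; proj₁; proj₂)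
open import Data.Sum.Base using (_⊎_; inj₁; inj₂)
open import Function.Base using (_∘_)
open import Function.Bundles using (Equivalence; Inverse; _⇔_; mk⇔)
open import Function.Definitions using (Congruent; Injective; Surjective)
open import Level using (_⊔_)
open import Relation.Binary.Definitions using (Decidable; _Respects_)
open import Relation.Binary.PropositionalEquality.Core as ≡ using (_≡_; _≢_)
import Relation.Binary.Reasoning.Setoid as SetoidReasoning
open import Relation.Nullary using (Dec; yes; no; ¬_; contradiction)
open import Relation.Nullary.Decidable using (map′; ¬?; decidable-stable)
open import Relation.Unary using (Pred) renaming (Decidable to Decidable₁)

-- Scalars are handled as elements fixed by `φ` rather than as members of the image of `ι`: being
-- fixed is what lets an element pass through every `ℒ u`, and counting the roots of x^q - x shows
-- that the two notions agree. A trace, or a value of `k` at a trace, can thus be pulled out as a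
-- scalar. The trace must also reach all of 𝔽_q, since otherwise Tr ∘ P = Q ∘ Tr would control Q on
-- a part of 𝔽_q only; it does, because E has degree n - 1 and so cannot annihilate K. No dimension
-- is counted. A self-map of a finite set is injective exactly when it is onto; this replaces linear
-- algebra in passing from kernels to common divisors, and leaves only one half of each bijectivity
-- to prove. The split on p ∣ n comes from E(1) = n. If p ∣ n, then x - 1 divides E, and coprimality
-- to E extends to xⁿ - 1. Otherwise h may vanish at 1, and only an inverse modulo E is available.

-- Identities in a commutative ring, applied later to polynomials.

module CommutativeRingTheory {c ℓ} (R : CommutativeRing c ℓ) where

  open CommutativeRing R public hiding (zero)
  open RingProperties ring public
    using (-‿distribʳ-*; -0#≈0#; -‿+-comm; -1*x≈-x)
  open GroupProperties +-group public
    using ()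
    renaming (x∙y⁻¹≈ε⇒x≈y to x-y≈0⇒x≈y; x≈y⇒x∙y⁻¹≈ε to x≈y⇒x-y≈0; ∙-cancelʳ to +-cancelʳ; ∙-cancelˡ to +-cancelˡ)
  open CommutativeSemigroupProperties +-commutativeSemigroup public
    using () renaming (interchange to +-interchange; x∙yz≈y∙xz to x+[y+z]≈y+[x+z])
  open SemiringSolver commutativeSemiring public using (solve; _:=_; _:+_; _:*_; con)
  open Exp semiring public
  open CommutativeExp commutativeSemiring public using (^-distrib-*)
  open Mult semiring public renaming (_×_ to _·_)
  open Sum semiring public using (sum; sum-cong-≋)
  module ≈-Reasoning = SetoidReasoning setoid

  x-y≈z⇒x≈z+y : ∀ {x y z} → x - y ≈ z → x ≈ z + y
  x-y≈z⇒x≈z+y {x} {y} {z} x-y≈z = +-cancelʳ (- y) x (z + y) (begin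
    x - y        ≈⟨ x-y≈z ⟩
    z            ≈⟨ +-identityʳ z ⟨
    z + 0#       ≈⟨ +-congˡ (-‿inverseʳ y) ⟨
    z + (y - y)  ≈⟨ +-assoc z y (- y) ⟨
    z + y - y    ∎)
    where open ≈-Reasoning

  x≈z+y⇒x-y≈z : ∀ {x y z} → x ≈ z + y → x - y ≈ z
  x≈z+y⇒x-y≈z {x} {y} {z} x≈z+y = begin
    x - y        ≈⟨ +-congʳ x≈z+y ⟩
    z + y - y    ≈⟨ +-assoc z y (- y) ⟩
    z + (y - y)  ≈⟨ +-congˡ (-‿inverseʳ y) ⟩
    z + 0#       ≈⟨ +-identityʳ z ⟩
    z            ∎
    where open ≈-Reasoning

  private variable
    a b h m r s t u v w x y z : Carrier

  -- Back-substitution in the extended Euclidean algorithm: a combination of `v` and the remainder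
  -- `r` becomes one of `u` and `v`. The negative is named `n` and treated as an atom, so that the
  -- rearrangement is a semiring identity and `b * s + n = 0` is applied separately.
  euclid-step : ∀ a b → u ≈ s * v + r → b * u + (a - b * s) * v ≈ a * v + b * r
  euclid-step {u} {s} {v} {r} a b u≈s*v+r = begin
    b * u + (a + n) * v                   ≈⟨ +-congʳ (*-congˡ u≈s*v+r) ⟩
    b * (s * v + r) + (a + n) * v
      ≈⟨ solve 6 (λ a b s v r n → b :* (s :* v :+ r) :+ (a :+ n) :* v := a :* v :+ b :* r :+ (b :* s :+ n) :* v)
           refl a b s v r n ⟩
    a * v + b * r + (b * s + n) * v       ≈⟨ +-congˡ (trans (*-congʳ (-‿inverseʳ (b * s))) (zeroˡ v)) ⟩
    a * v + b * r + 0#                    ≈⟨ +-identityʳ _ ⟩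
    a * v + b * r                         ∎
    where
    open ≈-Reasoning
    n = - (b * s)

  -- Reducing the Bézout coefficient of `h` modulo `m` keeps it an inverse of `h` modulo `m`.
  bézout-remainder : a * h + b * m ≈ 1# → a ≈ s * m + r → h * r ≈ - (s * h + b) * m + 1#
  bézout-remainder {a} {h} {b} {m} {s} {r} bézout a≈s*m+r = begin
    h * r                                     ≈⟨ +-identityˡ _ ⟨
    0# + h * r                                ≈⟨ +-congʳ (trans (*-congʳ (-‿inverseˡ (s * h + b))) (zeroˡ m)) ⟨
    (n + (s * h + b)) * m + h * r
      ≈⟨ solve 6 (λ n m s r h b → (n :+ (s :* h :+ b)) :* m :+ h :* r := n :* m :+ ((s :* m :+ r) :* h :+ b :* m))
           refl n m s r h b ⟩
    n * m + ((s * m + r) * h + b * m)         ≈⟨ +-congˡ (+-congʳ (*-congʳ a≈s*m+r)) ⟨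
    n * m + (a * h + b * m)                   ≈⟨ +-congˡ bézout ⟩
    n * m + 1#                                ∎
    where
    open ≈-Reasoning
    n = - (s * h + b)

  -- This is r = r(ht) = (hr)t = t modulo `m`. The cofactor is explicit because uniqueness of the
  -- reduced inverse is proved by showing that it vanishes.
  inverses-congruent : h * r ≈ w * m + 1# → h * t ≈ x * m + 1# → r - t ≈ (w * t - x * r) * m
  inverses-congruent {h} {r} {w} {m} {t} {x} hr≈wm+1 ht≈xm+1 = x≈z+y⇒x-y≈z (begin
    r                                ≈⟨ +-identityˡ r ⟨
    0# + r                           ≈⟨ +-congʳ (trans (*-congʳ (-‿inverseʳ (x * r))) (zeroˡ m)) ⟨
    (x * r + n) * m + r
      ≈⟨ solve 4 (λ r x m n → (x :* r :+ n) :* m :+ r := r :* (x :* m :+ con 1) :+ n :* m) refl r x m n ⟩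
    r * (x * m + 1#) + n * m  ≈⟨ +-congʳ (*-congˡ ht≈xm+1) ⟨
    r * (h * t) + n * m              ≈⟨ +-congʳ (solve 3 (λ h r t → r :* (h :* t) := h :* r :* t) refl h r t) ⟩
    h * r * t + n * m                ≈⟨ +-congʳ (*-congʳ hr≈wm+1) ⟩
    (w * m + 1#) * t + n * m
      ≈⟨ solve 4 (λ w t n m → (w :* m :+ con 1) :* t :+ n :* m := (w :* t :+ n) :* m :+ t) refl w t n m ⟩
    (w * t + n) * m + t              ∎)
    where
    open ≈-Reasoning
    n = - (x * r)

  -- Expanding the product of the two identities: coprimality to `u` and to `v` gives coprimality to
  -- `u * v`.
  bézout-* : a * h + b * u ≈ 1# → s * h + t * v ≈ 1# →
             (a * (s * h + t * v) + b * u * s) * h + b * t * (u * v) ≈ 1#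
  bézout-* {a} {h} {b} {u} {s} {t} {v} bézout₁ bézout₂ = begin
    (a * (s * h + t * v) + b * u * s) * h + b * t * (u * v)
      ≈⟨ solve 7 (λ a h b u s t v → (a :* (s :* h :+ t :* v) :+ b :* u :* s) :* h :+ b :* t :* (u :* v)
                   := (a :* h :+ b :* u) :* (s :* h :+ t :* v)) refl a h b u s t v ⟩
    (a * h + b * u) * (s * h + t * v)    ≈⟨ *-cong bézout₁ bézout₂ ⟩
    1# * 1#                              ≈⟨ *-identityˡ 1# ⟩
    1#                                   ∎
    where open ≈-Reasoning

  -- Here m = vz = szm. When `m` can be cancelled, `s` is therefore an inverse of `z`.
  vanish-factor : v * z ≈ m → v ≈ s * m → (s * z - 1#) * m ≈ 0#
  vanish-factor {v} {z} {m} {s} vz≈m v≈sm = begin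
    (s * z - 1#) * m         ≈⟨ distribʳ m _ _ ⟩
    s * z * m + - 1# * m     ≈⟨ +-cong (solve 3 (λ s z m → s :* z :* m := s :* m :* z) refl s z m) (-1*x≈-x m) ⟩
    s * m * z - m            ≈⟨ +-congʳ (trans (*-congʳ (sym v≈sm)) vz≈m) ⟩
    m - m                    ≈⟨ -‿inverseʳ m ⟩
    0#                       ∎
    where open ≈-Reasoning

  bézout-∣ : x * z ≈ u → y * z ≈ v → a * u + b * v ≈ w → (a * x + b * y) * z ≈ w
  bézout-∣ {x} {z} {u} {y} {v} {a} {b} {w} xz≈u yz≈v au+bv≈w = begin
    (a * x + b * y) * z
      ≈⟨ solve 5 (λ a x b y z → (a :* x :+ b :* y) :* z := a :* (x :* z) :+ b :* (y :* z)) refl a x b y z ⟩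
    a * (x * z) + b * (y * z)   ≈⟨ +-cong (*-congˡ xz≈u) (*-congˡ yz≈v) ⟩
    a * u + b * v               ≈⟨ au+bv≈w ⟩
    w                           ∎
    where open ≈-Reasoning

-- The polynomial ring: ring laws, evaluation, and division by monic polynomials.

module PolynomialProperties {c ℓ} (R : CommutativeRing c ℓ) where

  open CommutativeRingTheory R
  open Polynomial R

  scale : Carrier → Poly → Poly
  scale a = map (a *_)

  shift : Poly → Poly
  shift u = 0# ∷ u

  coeff-+ : ∀ u v i → coeff (u +ₚ v) i ≈ coeff u i + coeff v i
  coeff-+ []      v       i       = sym (+-identityˡ _)
  coeff-+ (a ∷ u) []      i       = sym (+-identityʳ _)
  coeff-+ (a ∷ u) (b ∷ v) zero    = refl
  coeff-+ (a ∷ u) (b ∷ v) (suc i) = coeff-+ u v i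

  coeff-neg : ∀ u i → coeff (-ₚ u) i ≈ - coeff u i
  coeff-neg []      i       = sym -0#≈0#
  coeff-neg (a ∷ u) zero    = refl
  coeff-neg (a ∷ u) (suc i) = coeff-neg u i

  coeff-scale : ∀ a u i → coeff (scale a u) i ≈ a * coeff u i
  coeff-scale a []      i       = sym (zeroʳ a)
  coeff-scale a (b ∷ u) zero    = refl
  coeff-scale a (b ∷ u) (suc i) = coeff-scale a u i

  -- Equality is coefficientwise, so `coeff` is an injective homomorphism into functions on ℕ and
  -- the group laws are pulled back along it.
  +ₚ-isAbelianGroup : IsAbelianGroup _≈ₚ_ _+ₚ_ 0ₚ (-ₚ_)
  +ₚ-isAbelianGroup =
    GroupMonomorphism.isAbelianGroup record
      { isGroupHomomorphism = record
        { isMonoidHomomorphism = record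
          { isMagmaHomomorphism = record
            { isRelHomomorphism = record { cong = coeff-≈ }
            ; homo = coeff-+
            }
          ; ε-homo = λ _ → refl
          }
        ; ⁻¹-homo = coeff-neg
        }
      ; injective = coeffwise
      }
      (Pointwise.isAbelianGroup ℕ +-isAbelianGroup)

  private
    module + = IsAbelianGroup +ₚ-isAbelianGroup
    module ≈ₚ-Reasoning = SetoidReasoning +.setoid

  ∷-cong : ∀ {a b u v} → a ≈ b → u ≈ₚ v → a ∷ u ≈ₚ b ∷ v
  ∷-cong a≈b u≈v = coeffwise λ { zero → a≈b ; (suc i) → coeff-≈ u≈v i }

  shift-[] : shift 0ₚ ≈ₚ 0ₚ
  shift-[] = coeffwise λ { zero → refl ; (suc i) → refl }

  shift-+ : ∀ u v → shift (u +ₚ v) ≈ₚ shift u +ₚ shift v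
  shift-+ u v = ∷-cong (sym (+-identityˡ 0#)) +.refl

  scale-cong : ∀ {a b u v} → a ≈ b → u ≈ₚ v → scale a u ≈ₚ scale b v
  scale-cong {a} {b} {u} {v} a≈b u≈v = coeffwise λ i → begin
    coeff (scale a u) i ≈⟨ coeff-scale a u i ⟩
    a * coeff u i       ≈⟨ *-cong a≈b (coeff-≈ u≈v i) ⟩
    b * coeff v i       ≈⟨ coeff-scale b v i ⟨
    coeff (scale b v) i ∎
    where open ≈-Reasoning

  scale-0 : ∀ u → scale 0# u ≈ₚ 0ₚ
  scale-0 u = coeffwise λ i → trans (coeff-scale 0# u i) (zeroˡ _)

  scale-1 : ∀ u → scale 1# u ≈ₚ u
  scale-1 u = coeffwise λ i → trans (coeff-scale 1# u i) (*-identityˡ _)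

  scale-distribˡ : ∀ a u v → scale a (u +ₚ v) ≈ₚ scale a u +ₚ scale a v
  scale-distribˡ a u v = coeffwise λ i → begin
    coeff (scale a (u +ₚ v)) i                ≈⟨ coeff-scale a (u +ₚ v) i ⟩
    a * coeff (u +ₚ v) i                      ≈⟨ *-congˡ (coeff-+ u v i) ⟩
    a * (coeff u i + coeff v i)               ≈⟨ distribˡ a _ _ ⟩
    a * coeff u i + a * coeff v i             ≈⟨ +-cong (coeff-scale a u i) (coeff-scale a v i) ⟨
    coeff (scale a u) i + coeff (scale a v) i ≈⟨ coeff-+ (scale a u) (scale a v) i ⟨
    coeff (scale a u +ₚ scale a v) i          ∎
    where open ≈-Reasoning

  scale-distribʳ : ∀ u a b → scale (a + b) u ≈ₚ scale a u +ₚ scale b u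
  scale-distribʳ u a b = coeffwise λ i → begin
    coeff (scale (a + b) u) i                 ≈⟨ coeff-scale (a + b) u i ⟩
    (a + b) * coeff u i                       ≈⟨ distribʳ _ a b ⟩
    a * coeff u i + b * coeff u i             ≈⟨ +-cong (coeff-scale a u i) (coeff-scale b u i) ⟨
    coeff (scale a u) i + coeff (scale b u) i ≈⟨ coeff-+ (scale a u) (scale b u) i ⟨
    coeff (scale a u +ₚ scale b u) i          ∎
    where open ≈-Reasoning

  scale-scale : ∀ a b u → scale (a * b) u ≈ₚ scale a (scale b u)
  scale-scale a b u = coeffwise λ i → begin
    coeff (scale (a * b) u) i       ≈⟨ coeff-scale (a * b) u i ⟩
    a * b * coeff u i               ≈⟨ *-assoc a b _ ⟩
    a * (b * coeff u i)             ≈⟨ *-congˡ (coeff-scale b u i) ⟨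
    a * coeff (scale b u) i         ≈⟨ coeff-scale a (scale b u) i ⟨
    coeff (scale a (scale b u)) i   ∎
    where open ≈-Reasoning

  private
    +ₚ-interchange : ∀ u v w x → (u +ₚ v) +ₚ (w +ₚ x) ≈ₚ (u +ₚ w) +ₚ (v +ₚ x)
    +ₚ-interchange = CommutativeSemigroupProperties.interchange
      (record { isCommutativeSemigroup = +.isCommutativeSemigroup })

    +ₚ-x∙yz≈y∙xz : ∀ u v w → u +ₚ (v +ₚ w) ≈ₚ v +ₚ (u +ₚ w)
    +ₚ-x∙yz≈y∙xz = CommutativeSemigroupProperties.x∙yz≈y∙xz
      (record { isCommutativeSemigroup = +.isCommutativeSemigroup })

  +ₚ-congˡ : ∀ u {v w} → v ≈ₚ w → u +ₚ v ≈ₚ u +ₚ w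
  +ₚ-congˡ u = +.∙-cong (+.refl {u})

  *ₚ-congˡ : ∀ u {v w} → v ≈ₚ w → u *ₚ v ≈ₚ u *ₚ w
  *ₚ-congˡ []      v≈w = +.refl
  *ₚ-congˡ (a ∷ u) v≈w = +.∙-cong (scale-cong refl v≈w) (∷-cong refl (*ₚ-congˡ u v≈w))

  *ₚ-zeroʳ : ∀ u → u *ₚ 0ₚ ≈ₚ 0ₚ
  *ₚ-zeroʳ []      = +.refl
  *ₚ-zeroʳ (a ∷ u) = +.trans (∷-cong refl (*ₚ-zeroʳ u)) shift-[]

  -- The product is defined by recursion on its left factor; this is the matching recursion on the
  -- right one, from which commutativity follows.
  *ₚ-∷ : ∀ u b v → u *ₚ (b ∷ v) ≈ₚ scale b u +ₚ shift (u *ₚ v)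
  *ₚ-∷ []      b v = +.sym shift-[]
  *ₚ-∷ (a ∷ u) b v = ∷-cong (+-congʳ (*-comm a b))
    (+.trans (+ₚ-congˡ (scale a v) (*ₚ-∷ u b v)) (+ₚ-x∙yz≈y∙xz (scale a v) (scale b u) _))

  *ₚ-comm : ∀ u v → u *ₚ v ≈ₚ v *ₚ u
  *ₚ-comm []      v = +.sym (*ₚ-zeroʳ v)
  *ₚ-comm (a ∷ u) v = begin
    scale a v +ₚ shift (u *ₚ v) ≈⟨ +ₚ-congˡ (scale a v) (∷-cong refl (*ₚ-comm u v)) ⟩
    scale a v +ₚ shift (v *ₚ u) ≈⟨ *ₚ-∷ v a u ⟨
    v *ₚ (a ∷ u)                ∎
    where open ≈ₚ-Reasoning

  -- Equal polynomials may be lists of different lengths, so congruence in the left factor is not a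
  -- plain recursion; commutativity transfers it from the right.
  *ₚ-cong : ∀ {u v w x} → u ≈ₚ v → w ≈ₚ x → u *ₚ w ≈ₚ v *ₚ x
  *ₚ-cong {u} {v} {w} {x} u≈v w≈x = begin
    u *ₚ w ≈⟨ *ₚ-congˡ u w≈x ⟩
    u *ₚ x ≈⟨ *ₚ-comm u x ⟩
    x *ₚ u ≈⟨ *ₚ-congˡ x u≈v ⟩
    x *ₚ v ≈⟨ *ₚ-comm x v ⟩
    v *ₚ x ∎
    where open ≈ₚ-Reasoning

  *ₚ-distribʳ : ∀ w u v → (u +ₚ v) *ₚ w ≈ₚ u *ₚ w +ₚ v *ₚ w
  *ₚ-distribʳ w []      v       = +.refl
  *ₚ-distribʳ w (a ∷ u) []      = +.sym (+.identityʳ _)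
  *ₚ-distribʳ w (a ∷ u) (b ∷ v) = begin
    scale (a + b) w +ₚ shift ((u +ₚ v) *ₚ w)
      ≈⟨ +.∙-cong (scale-distribʳ w a b)
           (+.trans (∷-cong refl (*ₚ-distribʳ w u v)) (shift-+ (u *ₚ w) (v *ₚ w))) ⟩
    (scale a w +ₚ scale b w) +ₚ (shift (u *ₚ w) +ₚ shift (v *ₚ w))
      ≈⟨ +ₚ-interchange (scale a w) (scale b w) (shift (u *ₚ w)) (shift (v *ₚ w)) ⟩
    (scale a w +ₚ shift (u *ₚ w)) +ₚ (scale b w +ₚ shift (v *ₚ w)) ∎
    where open ≈ₚ-Reasoning

  *ₚ-distribˡ : ∀ u v w → u *ₚ (v +ₚ w) ≈ₚ u *ₚ v +ₚ u *ₚ w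
  *ₚ-distribˡ u v w = begin
    u *ₚ (v +ₚ w)     ≈⟨ *ₚ-comm u (v +ₚ w) ⟩
    (v +ₚ w) *ₚ u     ≈⟨ *ₚ-distribʳ u v w ⟩
    v *ₚ u +ₚ w *ₚ u  ≈⟨ +.∙-cong (*ₚ-comm v u) (*ₚ-comm w u) ⟩
    u *ₚ v +ₚ u *ₚ w  ∎
    where open ≈ₚ-Reasoning

  scale-* : ∀ a u v → scale a u *ₚ v ≈ₚ scale a (u *ₚ v)
  scale-* a []      v = +.refl
  scale-* a (b ∷ u) v = begin
    scale (a * b) v +ₚ shift (scale a u *ₚ v)
      ≈⟨ +.∙-cong (scale-scale a b v) (∷-cong (sym (zeroʳ a)) (scale-* a u v)) ⟩
    scale a (scale b v) +ₚ scale a (shift (u *ₚ v))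
      ≈⟨ scale-distribˡ a (scale b v) (shift (u *ₚ v)) ⟨
    scale a (scale b v +ₚ shift (u *ₚ v)) ∎
    where open ≈ₚ-Reasoning

  shift-* : ∀ u v → shift u *ₚ v ≈ₚ shift (u *ₚ v)
  shift-* u v = +.trans (+.∙-cong (scale-0 v) +.refl) (+.identityˡ _)

  *ₚ-assoc : ∀ u v w → (u *ₚ v) *ₚ w ≈ₚ u *ₚ (v *ₚ w)
  *ₚ-assoc []      v w = +.refl
  *ₚ-assoc (a ∷ u) v w = begin
    (scale a v +ₚ shift (u *ₚ v)) *ₚ w
      ≈⟨ *ₚ-distribʳ w (scale a v) (shift (u *ₚ v)) ⟩
    scale a v *ₚ w +ₚ shift (u *ₚ v) *ₚ w
      ≈⟨ +.∙-cong (scale-* a v w) (shift-* (u *ₚ v) w) ⟩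
    scale a (v *ₚ w) +ₚ shift (u *ₚ v *ₚ w)
      ≈⟨ +ₚ-congˡ (scale a (v *ₚ w)) (∷-cong refl (*ₚ-assoc u v w)) ⟩
    scale a (v *ₚ w) +ₚ shift (u *ₚ (v *ₚ w)) ∎
    where open ≈ₚ-Reasoning

  C-* : ∀ a u → C a *ₚ u ≈ₚ scale a u
  C-* a u = +.trans (+ₚ-congˡ (scale a u) shift-[]) (+.identityʳ _)

  *ₚ-identityˡ : ∀ u → 1ₚ *ₚ u ≈ₚ u
  *ₚ-identityˡ u = +.trans (C-* 1# u) (scale-1 u)

  polyRing : CommutativeRing c ℓ
  polyRing = record
    { isCommutativeRing = record
      { isRing = record
        { +-isAbelianGroup = +ₚ-isAbelianGroup
        ; *-cong           = *ₚ-cong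
        ; *-assoc          = *ₚ-assoc
        ; *-identity       = *ₚ-identityˡ , λ u → +.trans (*ₚ-comm u 1ₚ) (*ₚ-identityˡ u)
        ; distrib          = *ₚ-distribˡ , *ₚ-distribʳ
        }
      ; *-comm = *ₚ-comm
      }
    }

  module Pₚ = CommutativeRingTheory polyRing

  eval-cong : ∀ {u v} → u ≈ₚ v → ∀ x → eval u x ≈ eval v x
  eval-cong {[]}    {[]}    u≈v x = refl
  eval-cong {[]}    {b ∷ v} u≈v x = begin
    0#                ≈⟨ zeroʳ x ⟨
    x * 0#            ≈⟨ +-identityˡ _ ⟨
    0# + x * 0#       ≈⟨ +-cong (coeff-≈ u≈v 0) (*-congˡ (eval-cong {[]} {v} (coeffwise (coeff-≈ u≈v ∘ suc)) x)) ⟩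
    b + x * eval v x  ∎
    where open ≈-Reasoning
  eval-cong {a ∷ u} {[]}    u≈v x = begin
    a + x * eval u x  ≈⟨ +-cong (coeff-≈ u≈v 0) (*-congˡ (eval-cong {u} {[]} (coeffwise (coeff-≈ u≈v ∘ suc)) x)) ⟩
    0# + x * 0#       ≈⟨ +-identityˡ _ ⟩
    x * 0#            ≈⟨ zeroʳ x ⟩
    0#                ∎
    where open ≈-Reasoning
  eval-cong {a ∷ u} {b ∷ v} u≈v x =
    +-cong (coeff-≈ u≈v 0) (*-congˡ (eval-cong {u} {v} (coeffwise (coeff-≈ u≈v ∘ suc)) x))

  eval-congʳ : ∀ u {x y} → x ≈ y → eval u x ≈ eval u y
  eval-congʳ []      x≈y = refl
  eval-congʳ (a ∷ u) x≈y = +-congˡ (*-cong x≈y (eval-congʳ u x≈y))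

  eval-C : ∀ a x → eval (C a) x ≈ a
  eval-C a x = trans (+-congˡ (zeroʳ x)) (+-identityʳ a)

  eval-X : ∀ x → eval X x ≈ x
  eval-X x = trans (+-identityˡ _) (trans (*-congˡ (eval-C 1# x)) (*-identityʳ x))

  eval-+ : ∀ u v x → eval (u +ₚ v) x ≈ eval u x + eval v x
  eval-+ []      v       x = sym (+-identityˡ _)
  eval-+ (a ∷ u) []      x = sym (+-identityʳ _)
  eval-+ (a ∷ u) (b ∷ v) x = begin
    (a + b) + x * eval (u +ₚ v) x             ≈⟨ +-congˡ (trans (*-congˡ (eval-+ u v x)) (distribˡ x _ _)) ⟩
    (a + b) + (x * eval u x + x * eval v x)   ≈⟨ +-interchange a b _ _ ⟩
    (a + x * eval u x) + (b + x * eval v x)   ∎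
    where open ≈-Reasoning

  eval-neg : ∀ u x → eval (-ₚ u) x ≈ - eval u x
  eval-neg []      x = sym -0#≈0#
  eval-neg (a ∷ u) x = begin
    - a + x * eval (-ₚ u) x   ≈⟨ +-congˡ (*-congˡ (eval-neg u x)) ⟩
    - a + x * - eval u x      ≈⟨ +-congˡ (-‿distribʳ-* x _) ⟨
    - a + - (x * eval u x)    ≈⟨ -‿+-comm a _ ⟩
    - (a + x * eval u x)      ∎
    where open ≈-Reasoning

  eval-minus : ∀ u v x → eval (u -ₚ v) x ≈ eval u x - eval v x
  eval-minus u v x = trans (eval-+ u (-ₚ v) x) (+-congˡ (eval-neg v x))

  eval-X-C : ∀ a x → eval (X -ₚ C a) x ≈ x - a
  eval-X-C a x = trans (eval-minus X (C a) x) (+-cong (eval-X x) (-‿cong (eval-C a x)))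

  eval-scale : ∀ a u x → eval (scale a u) x ≈ a * eval u x
  eval-scale a []      x = sym (zeroʳ a)
  eval-scale a (b ∷ u) x = trans (+-congˡ (*-congˡ (eval-scale a u x)))
    (solve 4 (λ a b x e → a :* b :+ x :* (a :* e) := a :* (b :+ x :* e)) refl a b x (eval u x))

  eval-* : ∀ u v x → eval (u *ₚ v) x ≈ eval u x * eval v x
  eval-* []      v x = sym (zeroˡ _)
  eval-* (a ∷ u) v x = begin
    eval (scale a v +ₚ shift (u *ₚ v)) x
      ≈⟨ eval-+ (scale a v) (shift (u *ₚ v)) x ⟩
    eval (scale a v) x + (0# + x * eval (u *ₚ v) x)
      ≈⟨ +-cong (eval-scale a v x) (trans (+-identityˡ _) (*-congˡ (eval-* u v x))) ⟩
    a * eval v x + x * (eval u x * eval v x)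
      ≈⟨ solve 4 (λ a x u v → a :* v :+ x :* (u :* v) := (a :+ x :* u) :* v) refl a x (eval u x) (eval v x) ⟩
    (a + x * eval u x) * eval v x ∎
    where open ≈-Reasoning

  eval-^ : ∀ u m x → eval (u ^ₚ m) x ≈ eval u x ^ m
  eval-^ u zero    x = eval-C 1# x
  eval-^ u (suc m) x = trans (eval-* u (u ^ₚ m) x) (*-congˡ (eval-^ u m x))

  eval-X^ : ∀ m x → eval (X ^ₚ m) x ≈ x ^ m
  eval-X^ m x = trans (eval-^ X m x) (^-congˡ m (eval-X x))

  eval-∘ : ∀ u v x → eval (u ∘ₚ v) x ≈ eval u (eval v x)
  eval-∘ []      v x = refl
  eval-∘ (a ∷ u) v x = begin
    eval (C a +ₚ v *ₚ (u ∘ₚ v)) x           ≈⟨ eval-+ (C a) (v *ₚ (u ∘ₚ v)) x ⟩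
    eval (C a) x + eval (v *ₚ (u ∘ₚ v)) x   ≈⟨ +-cong (eval-C a x) (eval-* v (u ∘ₚ v) x) ⟩
    a + eval v x * eval (u ∘ₚ v) x          ≈⟨ +-congˡ (*-congˡ (eval-∘ u v x)) ⟩
    a + eval v x * eval u (eval v x)        ∎
    where open ≈-Reasoning

  eval-sum : ∀ {m} (u : Fin m → Poly) x → eval (sumₚ u) x ≈ sum (λ i → eval (u i) x)
  eval-sum {zero}  u x = refl
  eval-sum {suc m} u x =
    trans (eval-+ (u zero) (sumₚ (u ∘ suc)) x) (+-congˡ (eval-sum (u ∘ suc) x))

  DegreeBelow-resp : ∀ {d u v} → u ≈ₚ v → DegreeBelow d u → DegreeBelow d v
  DegreeBelow-resp u≈v deg i d≤i = trans (sym (coeff-≈ u≈v i)) (deg i d≤i)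

  DegreeBelow-mono : ∀ {d e u} → d ≤ e → DegreeBelow d u → DegreeBelow e u
  DegreeBelow-mono d≤e deg i e≤i = deg i (ℕ.≤-trans d≤e e≤i)

  DegreeBelow-length : ∀ u → DegreeBelow (length u) u
  DegreeBelow-length []      i       _         = refl
  DegreeBelow-length (a ∷ u) (suc i) (s≤s l≤i) = DegreeBelow-length u i l≤i

  DegreeBelow-+ : ∀ {d u v} → DegreeBelow d u → DegreeBelow d v → DegreeBelow d (u +ₚ v)
  DegreeBelow-+ {d} {u} {v} du dv i d≤i =
    trans (coeff-+ u v i) (trans (+-cong (du i d≤i) (dv i d≤i)) (+-identityˡ 0#))

  DegreeBelow-neg : ∀ {d u} → DegreeBelow d u → DegreeBelow d (-ₚ u)
  DegreeBelow-neg {u = u} du i d≤i =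
    trans (coeff-neg u i) (trans (-‿cong (du i d≤i)) -0#≈0#)

  DegreeBelow-scale : ∀ {d u} a → DegreeBelow d u → DegreeBelow d (scale a u)
  DegreeBelow-scale {u = u} a du i d≤i =
    trans (coeff-scale a u i) (trans (*-congˡ (du i d≤i)) (zeroʳ a))

  DegreeBelow-0 : ∀ {u} → DegreeBelow 0 u → u ≈ₚ 0ₚ
  DegreeBelow-0 du = coeffwise λ i → du i z≤n

  -- A list representing a polynomial of degree below d can be much longer than d.
  trim : ∀ d u → DegreeBelow d u → ∃ λ v → v ≈ₚ u × length v ≤ d
  trim zero    u       du = [] , Pₚ.sym (DegreeBelow-0 du) , z≤n
  trim (suc d) []      du = [] , Pₚ.refl , z≤n
  trim (suc d) (a ∷ u) du =
    let v , v≈u , ≤d = trim d u (λ i d≤i → du (suc i) (s≤s d≤i))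
    in a ∷ v , ∷-cong refl v≈u , s≤s ≤d

  record Monic (d : ℕ) (m : Poly) : Set ℓ where
    constructor _,_
    field
      leading     : coeff m d ≈ 1#
      degreeBelow : DegreeBelow (suc d) m

  coeff-∷* : ∀ a u v i → coeff ((a ∷ u) *ₚ v) i ≈ a * coeff v i + coeff (shift (u *ₚ v)) i
  coeff-∷* a u v i =
    trans (coeff-+ (scale a v) (shift (u *ₚ v)) i) (+-congʳ (coeff-scale a v i))

  monic-X-C : ∀ a → Monic 1 (X -ₚ C a)
  monic-X-C a = refl , λ { (suc zero) (s≤s ()) ; (suc (suc i)) _ → refl }

  -- Multiplication by a monic polynomial of degree `e` raises degrees by exactly `e`, over any
  -- commutative ring. In the induction on `u`, the part `a * m` has no coefficients above `e`, so
  -- beyond that point the vanishing of the product passes to `u *ₚ m` with indices lowered by one.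
  degree-factor : ∀ {m} e → Monic e m → ∀ d u → DegreeBelow (d ℕ.+ e) (u *ₚ m) → DegreeBelow d u
  degree-factor e mon d [] deg i _ = refl
  degree-factor {m} e mon d (a ∷ u) deg = go d deg
    where
    open Monic mon
    open ≈-Reasoning

    tail : ∀ {d} j → e ≤ j → d ≤ suc j → DegreeBelow d ((a ∷ u) *ₚ m) → coeff (u *ₚ m) j ≈ 0#
    tail j e≤j d≤sj deg = begin
      coeff (u *ₚ m) j                           ≈⟨ +-identityˡ _ ⟨
      0# + coeff (u *ₚ m) j                      ≈⟨ +-congʳ (trans (*-congˡ (degreeBelow (suc j) (s≤s e≤j))) (zeroʳ a)) ⟨
      a * coeff m (suc j) + coeff (u *ₚ m) j     ≈⟨ coeff-∷* a u m (suc j) ⟨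
      coeff ((a ∷ u) *ₚ m) (suc j)               ≈⟨ deg (suc j) d≤sj ⟩
      0#                                         ∎

    go : ∀ d → DegreeBelow (d ℕ.+ e) ((a ∷ u) *ₚ m) → DegreeBelow d (a ∷ u)
    go (suc d) deg (suc i) (s≤s d≤i) = degree-factor e mon d u
      (λ j d+e≤j → tail j (ℕ.≤-trans (ℕ.m≤n+m e d) d+e≤j) (s≤s d+e≤j) deg) i d≤i
    -- With `d = 0` the tail must vanish first; the product is then `a` times `m`, and its
    -- coefficient at `e` is `a` itself.
    go zero deg = head
      where
      u≈0 : DegreeBelow 0 u
      u≈0 = degree-factor e mon 0 u (λ j e≤j → tail j e≤j (ℕ.m≤n⇒m≤1+n e≤j) deg)

      shift≈0 : shift (u *ₚ m) ≈ₚ 0ₚ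
      shift≈0 = Pₚ.trans (∷-cong refl (*ₚ-cong {u} (DegreeBelow-0 u≈0) (Pₚ.refl {m}))) shift-[]

      head : DegreeBelow 0 (a ∷ u)
      head (suc i) _ = u≈0 i z≤n
      head zero    _ = begin
        a                                            ≈⟨ *-identityʳ a ⟨
        a * 1#                                       ≈⟨ *-congˡ leading ⟨
        a * coeff m e                                ≈⟨ +-identityʳ _ ⟨
        a * coeff m e + 0#                           ≈⟨ +-congˡ (coeff-≈ shift≈0 e) ⟨
        a * coeff m e + coeff (shift (u *ₚ m)) e     ≈⟨ coeff-∷* a u m e ⟨
        coeff ((a ∷ u) *ₚ m) e                       ≈⟨ deg e ℕ.≤-refl ⟩
        0#                                           ∎

  -- Recursion on the dividend as in Horner's scheme: from u = sm + r one gets a + xu = (xs)m + (a +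
  -- xr), and `a ∷ r` has degree at most `d`. Subtracting its coefficient `b` at `d` times `m`
  -- restores the bound. Nothing is inverted, since `m` is monic.
  divide : ∀ {d m} → Monic d m → ∀ u → ∃₂ λ s r → (u ≈ₚ s *ₚ m +ₚ r) × DegreeBelow d r
  divide mon [] = [] , [] , Pₚ.refl , λ _ _ → refl
  divide {d} {m} mon (a ∷ u) with divide mon u
  ... | s , r , u≈sm+r , dr = s′ , r′ , eq , deg
    where
    open Monic mon
    w = a ∷ r
    b = coeff w d
    s′ = b ∷ s
    r′ = w -ₚ scale b m

    eq : a ∷ u ≈ₚ s′ *ₚ m +ₚ r′
    eq = Pₚ.sym (begin
      scale b m +ₚ shift (s *ₚ m) +ₚ (w +ₚ -ₚ scale b m)
        ≈⟨ Pₚ.solve 4 (λ x y z t → x Pₚ.:+ y Pₚ.:+ (z Pₚ.:+ t) Pₚ.:= y Pₚ.:+ z Pₚ.:+ (x Pₚ.:+ t))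
             Pₚ.refl (scale b m) (shift (s *ₚ m)) w (-ₚ scale b m) ⟩
      shift (s *ₚ m) +ₚ w +ₚ (scale b m +ₚ -ₚ scale b m)
        ≈⟨ +ₚ-congˡ (shift (s *ₚ m) +ₚ w) (Pₚ.-‿inverseʳ (scale b m)) ⟩
      shift (s *ₚ m) +ₚ w +ₚ 0ₚ
        ≈⟨ Pₚ.+-identityʳ _ ⟩
      shift (s *ₚ m) +ₚ w
        ≈⟨ ∷-cong (+-identityˡ a) (Pₚ.sym u≈sm+r) ⟩
      a ∷ u ∎)
      where open Pₚ.≈-Reasoning

    w-deg : ∀ i → suc d ≤ i → coeff w i ≈ 0#
    w-deg (suc i) (s≤s d≤i) = dr i d≤i

    deg : DegreeBelow d r′
    deg i d≤i = begin
      coeff (w +ₚ -ₚ scale b m) i             ≈⟨ coeff-+ w (-ₚ scale b m) i ⟩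
      coeff w i + coeff (-ₚ scale b m) i      ≈⟨ +-congˡ (coeff-neg (scale b m) i) ⟩
      coeff w i - coeff (scale b m) i         ≈⟨ +-congˡ (-‿cong (coeff-scale b m i)) ⟩
      coeff w i - b * coeff m i               ≈⟨ +-congˡ (-‿cong (same (ℕ.m≤n⇒m<n∨m≡n d≤i))) ⟩
      coeff w i - coeff w i                   ≈⟨ -‿inverseʳ _ ⟩
      0#                                      ∎
      where
  
      open ≈-Reasoning

      same : d ℕ.< i ⊎ d ≡ i → b * coeff m i ≈ coeff w i
      same (inj₁ d<i)    = trans (*-congˡ (degreeBelow i d<i)) (trans (zeroʳ b) (sym (w-deg i d<i)))
      same (inj₂ ≡.refl) = trans (*-congˡ leading) (*-identityʳ b)

  X* : ∀ u → X *ₚ u ≈ₚ shift u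
  X* u = Pₚ.trans (shift-* 1ₚ u) (∷-cong refl (*ₚ-identityˡ u))

  coeff-X^-≡ : ∀ k → coeff (X ^ₚ k) k ≈ 1#
  coeff-X^-≡ zero    = refl
  coeff-X^-≡ (suc k) = trans (coeff-≈ (X* (X ^ₚ k)) (suc k)) (coeff-X^-≡ k)

  coeff-X^-≢ : ∀ k i → i ≢ k → coeff (X ^ₚ k) i ≈ 0#
  coeff-X^-≢ zero    zero    i≢k = contradiction ≡.refl i≢k
  coeff-X^-≢ zero    (suc i) i≢k = refl
  coeff-X^-≢ (suc k) zero    i≢k = coeff-≈ (X* (X ^ₚ k)) 0
  coeff-X^-≢ (suc k) (suc i) i≢k =
    trans (coeff-≈ (X* (X ^ₚ k)) (suc i)) (coeff-X^-≢ k i (i≢k ∘ ≡.cong suc))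

  monic-X^-u : ∀ {k u} → DegreeBelow k u → Monic k (X ^ₚ k -ₚ u)
  monic-X^-u {k} {u} deg = leading , degreeBelow
    where
    coeff-minus : ∀ i → coeff u i ≈ 0# → coeff (X ^ₚ k -ₚ u) i ≈ coeff (X ^ₚ k) i
    coeff-minus i u_i≈0 = trans (coeff-+ (X ^ₚ k) (-ₚ u) i)
      (trans (+-congˡ (trans (coeff-neg u i) (trans (-‿cong u_i≈0) -0#≈0#))) (+-identityʳ _))

    leading : coeff (X ^ₚ k -ₚ u) k ≈ 1#
    leading = trans (coeff-minus k (deg k ℕ.≤-refl)) (coeff-X^-≡ k)

    degreeBelow : DegreeBelow (suc k) (X ^ₚ k -ₚ u)
    degreeBelow i k<i = trans (coeff-minus i (deg i (ℕ.<⇒≤ k<i))) (coeff-X^-≢ k i (ℕ.>⇒≢ k<i))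

  monic-[Xⁿ-1]/[X-1] : ∀ {n} → 1 ≤ n → Monic (n ∸ 1) ([Xⁿ-1]/[X-1] n)
  monic-[Xⁿ-1]/[X-1] (s≤s {n = n} z≤n) = leading n , degreeBelow (suc n)
    where
    leading : ∀ n → coeff (replicate (suc n) 1#) n ≈ 1#
    leading zero    = refl
    leading (suc n) = leading n

    degreeBelow : ∀ n → DegreeBelow n (replicate n 1#)
    degreeBelow zero    i       _         = refl
    degreeBelow (suc n) (suc i) (s≤s n≤i) = degreeBelow n i n≤i

  -- The source of both the case distinction on `p ∣ n` and the denominator `n` in the second case.
  eval-[Xⁿ-1]/[X-1] : ∀ n → eval ([Xⁿ-1]/[X-1] n) 1# ≈ n · 1#
  eval-[Xⁿ-1]/[X-1] zero    = refl
  eval-[Xⁿ-1]/[X-1] (suc n) = +-congˡ (trans (*-identityˡ _) (eval-[Xⁿ-1]/[X-1] n))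

  monic≉0 : ∀ {d u} → 1# ≉ 0# → Monic d u → ¬ (u ≈ₚ 0ₚ)
  monic≉0 {d} 1≉0 monic u≈0 = 1≉0 (trans (sym (Monic.leading monic)) (coeff-≈ u≈0 d))

  factor-root : ∀ u a → eval u a ≈ 0# → ∃ λ s → u ≈ₚ s *ₚ (X -ₚ C a)
  factor-root u a u[a]≈0 with divide (monic-X-C a) u
  ... | s , r , u≈s[X-a]+r , deg-r = s , Pₚ.trans u≈s[X-a]+r
      (Pₚ.trans (+ₚ-congˡ (s *ₚ (X -ₚ C a)) r≈0) (Pₚ.+-identityʳ _))
    where
    open ≈-Reasoning

    r≈C : r ≈ₚ C (coeff r 0)
    r≈C = coeffwise λ { zero → refl ; (suc i) → deg-r (suc i) (s≤s z≤n) }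

    r₀≈0 : coeff r 0 ≈ 0#
    r₀≈0 = begin
      coeff r 0                                  ≈⟨ trans (eval-cong r≈C a) (eval-C _ a) ⟨
      eval r a                                   ≈⟨ +-identityˡ _ ⟨
      0# + eval r a                              ≈⟨ +-congʳ (trans (*-congˡ (trans (eval-X-C a a) (-‿inverseʳ a))) (zeroʳ _)) ⟨
      eval s a * eval (X -ₚ C a) a + eval r a    ≈⟨ +-congʳ (eval-* s (X -ₚ C a) a) ⟨
      eval (s *ₚ (X -ₚ C a)) a + eval r a        ≈⟨ eval-+ (s *ₚ (X -ₚ C a)) r a ⟨
      eval (s *ₚ (X -ₚ C a) +ₚ r) a              ≈⟨ eval-cong u≈s[X-a]+r a ⟨
      eval u a                                   ≈⟨ u[a]≈0 ⟩
      0#                                         ∎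

    r≈0 : r ≈ₚ 0ₚ
    r≈0 = Pₚ.trans r≈C (Pₚ.trans (∷-cong r₀≈0 Pₚ.refl) shift-[])

-- Binomial coefficients divisible by a prime.

prime∣m!⇒≤ : ∀ {p} m → Prime p → p ∣ m ! → p ≤ m
prime∣m!⇒≤ {p} zero p-prime p∣1 =
  contradiction (∣1⇒≡1 p∣1) (ℕ.nonTrivial⇒≢1 {{prime⇒nonTrivial p-prime}})
prime∣m!⇒≤ {p} (suc m) p-prime p∣ with euclidsLemma (suc m) (m !) p-prime p∣
... | inj₁ p∣1+m = ∣⇒≤ p∣1+m
... | inj₂ p∣m!  = ℕ.m≤n⇒m≤1+n (prime∣m!⇒≤ m p-prime p∣m!)

m∣m! : ∀ m .{{_ : ℕ.NonZero m}} → m ∣ m !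
m∣m! (suc m) = m∣m*n (m !)

-- The prime divides p!, which is the binomial coefficient times k! and (p-k)!, and it divides
-- neither factorial because both arguments are smaller than `p`.
prime∣C : ∀ {p k} → Prime p → 1 ≤ k → k ℕ.< p → p ∣ p C k
prime∣C {p} {k} p-prime 1≤k k<p with euclidsLemma (p C k) (k ! ℕ.* (p ∸ k) !) p-prime p∣product
  where
  p∣product : p ∣ (p C k) ℕ.* (k ! ℕ.* (p ∸ k) !)
  p∣product = ≡.subst (p ∣_)
    (≡.sym (≡.trans (≡.cong (ℕ._* (k ! ℕ.* (p ∸ k) !)) (nCk≡n!/k![n-k]! (ℕ.<⇒≤ k<p)))
                    (ℕ.m/n*n≡m {{ℕ._!*_!≢0 k (p ∸ k)}} (k![n∸k]!∣n! (ℕ.<⇒≤ k<p)))))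
    (m∣m! p {{prime⇒nonZero p-prime}})
... | inj₁ p∣C = p∣C
... | inj₂ p∣k![p-k]! with euclidsLemma (k !) ((p ∸ k) !) p-prime p∣k![p-k]!
...   | inj₁ p∣k!     = contradiction (prime∣m!⇒≤ k p-prime p∣k!) (ℕ.<⇒≱ k<p)
...   | inj₂ p∣[p-k]! = contradiction (prime∣m!⇒≤ (p ∸ k) p-prime p∣[p-k]!)
          (ℕ.<⇒≱ (ℕ.∸-monoʳ-< 1≤k (ℕ.<⇒≤ k<p)))

-- Finite fields: counting arguments, x^m = x, and roots of polynomials.

module FiniteFieldTheory {c ℓ m} (field′ : FiniteField c ℓ m) where

  open FiniteField field′ public
    using (commutativeRing; 1≉0; _⁻¹; *-inverseʳ; enumeration)
  open CommutativeRingTheory commutativeRing public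
  open PolynomialProperties commutativeRing public
  open Polynomial commutativeRing
  open Inverse enumeration using ()
    renaming (to to element; from to index; from-cong to index-cong;
              strictlyInverseˡ to element-index; strictlyInverseʳ to index-element) public

  infix 4 _≟_

  _≟_ : Decidable _≈_
  x ≟ y = map′ index⇒≈ index-cong (index x Fin.≟ index y)
    where
    index⇒≈ : index x ≡ index y → x ≈ y
    index⇒≈ eq = trans (sym (element-index x)) (trans (reflexive (≡.cong element eq)) (element-index y))

  element-injective : Injective _≡_ _≈_ element
  element-injective {i} {j} eq =
    ≡.trans (≡.sym (index-element i)) (≡.trans (index-cong eq) (index-element j))

  module _ {p} {P : Pred Carrier p} (resp : P Respects _≈_) (P? : Decidable₁ P) where

    any? : Dec (∃ P)
    any? = map′ (λ { (i , Pi) → element i , Pi })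
                (λ { (x , Px) → index x , resp (sym (element-index x)) Px })
                (Fin.any? (P? ∘ element))

  -- Pigeonhole: a missed value `y` together with the m values of `f` would embed a set of m + 1
  -- elements into one of m.
  injective⇒surjective : ∀ {f} → Congruent _≈_ _≈_ f → Injective _≈_ _≈_ f → Surjective _≈_ _≈_ f
  injective⇒surjective {f} cong inj y
    with any? (λ x≈x′ → trans (cong (sym x≈x′))) (λ x → f x ≟ y)
  ... | yes (x , fx≈y) = x , λ z≈x → trans (cong z≈x) fx≈y
  ... | no ∄ = contradiction (Fin.injective⇒≤ {f = g} g-injective) ℕ.1+n≰n
    where
    h : Fin (suc m) → Carrier
    h zero    = y
    h (suc i) = f (element i)

    g : Fin (suc m) → Fin m
    g = index ∘ h

    h-injective : ∀ {i j} → h i ≈ h j → i ≡ j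
    h-injective {zero}  {zero}  eq = ≡.refl
    h-injective {zero}  {suc j} eq = contradiction (element j , sym eq) ∄
    h-injective {suc i} {zero}  eq = contradiction (element i , eq) ∄
    h-injective {suc i} {suc j} eq = ≡.cong suc (element-injective (inj eq))

    g-injective : Injective _≡_ _≡_ g
    g-injective {i} {j} eq = h-injective
      (trans (sym (element-index (h i))) (trans (reflexive (≡.cong element eq)) (element-index (h j))))

  -- A section `s` of `f` is injective, hence onto; so every element has the form `s a`, and on such
  -- elements `f` determines `a`.
  surjective⇒injective : ∀ {f} → Congruent _≈_ _≈_ f → Surjective _≈_ _≈_ f → Injective _≈_ _≈_ f
  surjective⇒injective {f} cong surj {x} {y} fx≈fy = begin
    x             ≈⟨ hit x ⟨
    s (proj₁ (s-surjective x))   ≈⟨ s-cong (begin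
      a                    ≈⟨ f∘s a ⟨
      f (s a)              ≈⟨ cong (hit x) ⟩
      f x                  ≈⟨ fx≈fy ⟩
      f y                  ≈⟨ cong (hit y) ⟨
      f (s b)              ≈⟨ f∘s b ⟩
      b                    ∎) ⟩
    s (proj₁ (s-surjective y))   ≈⟨ hit y ⟩
    y             ∎
    where
    open ≈-Reasoning

    s : Carrier → Carrier
    -- Chosen preimages of equal elements need not be equal. Choosing at the canonical
    -- representative `element (index y)` makes `s` respect `_≈_`.
    s y = proj₁ (surj (element (index y)))

    s-cong : Congruent _≈_ _≈_ s
    s-cong y≈y′ = reflexive (≡.cong (proj₁ ∘ surj ∘ element) (index-cong y≈y′))

    f∘s : ∀ y → f (s y) ≈ y
    f∘s y = trans (proj₂ (surj (element (index y))) refl) (element-index y)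

    s-surjective : Surjective _≈_ _≈_ s
    s-surjective = injective⇒surjective s-cong λ {y} {y′} eq →
      trans (sym (f∘s y)) (trans (cong eq) (f∘s y′))

    a = proj₁ (s-surjective x)
    b = proj₁ (s-surjective y)

    hit : ∀ x → s (proj₁ (s-surjective x)) ≈ x
    hit x = proj₂ (s-surjective x) refl

  x*y≈0⇒y≈0 : ∀ {x y} → x ≉ 0# → x * y ≈ 0# → y ≈ 0#
  x*y≈0⇒y≈0 {x} {y} x≉0 xy≈0 = begin
    y                ≈⟨ *-identityˡ y ⟨
    1# * y           ≈⟨ *-congʳ (*-inverseʳ x x≉0) ⟨
    x * x ⁻¹ * y     ≈⟨ solve 3 (λ x z y → x :* z :* y := z :* (x :* y)) refl x (x ⁻¹) y ⟩
    x ⁻¹ * (x * y)   ≈⟨ *-congˡ xy≈0 ⟩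
    x ⁻¹ * 0#        ≈⟨ zeroʳ _ ⟩
    0#               ∎
    where open ≈-Reasoning

  x*y≉0 : ∀ {x y} → x ≉ 0# → y ≉ 0# → x * y ≉ 0#
  x*y≉0 x≉0 y≉0 xy≈0 = y≉0 (x*y≈0⇒y≈0 x≉0 xy≈0)

  *-cancelʳ-≉0 : ∀ {x y z} → z ≉ 0# → x * z ≈ y * z → x ≈ y
  *-cancelʳ-≉0 {x} {y} {z} z≉0 xz≈yz = begin
    x                ≈⟨ *-identityʳ x ⟨
    x * 1#           ≈⟨ *-congˡ (*-inverseʳ z z≉0) ⟨
    x * (z * z ⁻¹)   ≈⟨ *-assoc x z _ ⟨
    x * z * z ⁻¹     ≈⟨ *-congʳ xz≈yz ⟩
    y * z * z ⁻¹     ≈⟨ *-assoc y z _ ⟩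
    y * (z * z ⁻¹)   ≈⟨ *-congˡ (*-inverseʳ z z≉0) ⟩
    y * 1#           ≈⟨ *-identityʳ y ⟩
    y                ∎
    where open ≈-Reasoning

  x^k≈0⇒x≈0 : ∀ {x} k → x ^ k ≈ 0# → x ≈ 0#
  x^k≈0⇒x≈0 zero    1≈0  = contradiction 1≈0 1≉0
  x^k≈0⇒x≈0 {x} (suc k) x*x^k≈0 with x ≟ 0#
  ... | yes x≈0 = x≈0
  ... | no  x≉0 = x^k≈0⇒x≈0 k (x*y≈0⇒y≈0 x≉0 x*x^k≈0)

  -- Stated for any commutative monoid because it serves sums (translation by 1) as well as products
  -- (multiplication by a nonzero element).
  sum-reindex : ∀ {a ℓ′} (M : CommutativeMonoid a ℓ′) →
    let module M = CommutativeMonoid M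
        module ∑ = CommutativeMonoidSum M
    in
    (t : Carrier → M.Carrier) → Congruent _≈_ M._≈_ t →
    {f g : Carrier → Carrier} → Congruent _≈_ _≈_ f → Congruent _≈_ _≈_ g →
    (∀ x → f (g x) ≈ x) → (∀ x → g (f x) ≈ x) →
    ∑.sum (t ∘ element) M.≈ ∑.sum (t ∘ f ∘ element)
  sum-reindex M t t-cong {f} {g} f-cong g-cong fg gf =
    M.trans (∑.sum-permute (t ∘ element) π) (∑.sum-cong-≋ (λ i → t-cong (element-index (f (element i)))))
    where
    module M = CommutativeMonoid M
    module ∑ = CommutativeMonoidSum M

    conj : ∀ {f g : Carrier → Carrier} → Congruent _≈_ _≈_ f → (∀ x → f (g x) ≈ x) → ∀ i →
           index (f (element (index (g (element i))))) ≡ i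
    conj f-cong fg i = ≡.trans
      (index-cong (trans (f-cong (element-index _)) (fg (element i)))) (index-element i)

    π : Permutation.Permutation m m
    π = Permutation.permutation (index ∘ f ∘ element) (index ∘ g ∘ element)
          (conj f-cong fg) (conj g-cong gf)

  private
    module ∑ = CommutativeMonoidSum +-commutativeMonoid
    module ∏ = CommutativeMonoidSum *-commutativeMonoid

  -- Translation by 1 permutes the field, so the sum of all elements is unchanged when 1 is added to
  -- each of the m summands.
  m·1≈0 : m · 1# ≈ 0#
  m·1≈0 = +-cancelˡ S (m · 1#) 0# (begin
    S + m · 1#                         ≈⟨ +-congˡ (∑.sum-replicate m) ⟨
    S + ∑.sum {m} (λ _ → 1#)           ≈⟨ ∑.∑-distrib-+ element (λ _ → 1#) ⟨
    ∑.sum (λ i → element i + 1#)       ≈⟨ sum-reindex +-commutativeMonoid (λ x → x) (λ eq → eq) +-congʳ +-congʳ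
                                            (λ x → trans (+-assoc x (- 1#) 1#) (trans (+-congˡ (-‿inverseˡ 1#)) (+-identityʳ x)))
                                            (λ x → trans (+-assoc x 1# (- 1#)) (trans (+-congˡ (-‿inverseʳ 1#)) (+-identityʳ x))) ⟨
    S                                  ≈⟨ +-identityʳ S ⟨
    S + 0#                             ∎)
    where
    open ≈-Reasoning
    S = ∑.sum element

  product≉0 : ∀ {k} (t : Fin k → Carrier) → (∀ i → t i ≉ 0#) → ∏.sum t ≉ 0#
  product≉0 {zero}  t t≉0 = 1≉0
  product≉0 {suc k} t t≉0 = x*y≉0 (t≉0 zero) (product≉0 (t ∘ suc) (t≉0 ∘ suc))

  product-single : ∀ {k} (t : Fin k → Carrier) i → (∀ j → j ≢ i → t j ≈ 1#) → ∏.sum t ≈ t i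
  product-single {suc k} t i t≈1 = begin
    ∏.sum t                              ≈⟨ ∏.sum-remove {i = i} t ⟩
    t i * ∏.sum (t ∘ punchIn i)          ≈⟨ *-congˡ (∏.sum-cong-≋ (λ j → t≈1 (punchIn i j) (Fin.punchInᵢ≢i i j))) ⟩
    t i * ∏.sum {k} (λ _ → 1#)           ≈⟨ *-congˡ (∏.sum-replicate-zero k) ⟩
    t i * 1#                             ≈⟨ *-identityʳ _ ⟩
    t i                                  ∎
    where open ≈-Reasoning

  -- Multiplication by a ≠ 0 permutes the nonzero elements, so their product G satisfies
  -- G = aᵐ⁻¹ G.  The products run over all of the field, with 1 in place of 0.
  x^m≈x : ∀ x → x ^ m ≈ x
  x^m≈x a with a ≟ 0#
  -- This case needs m > 0, as 0⁰ = 1; the index of 0 in `Fin m` is the witness.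
  ... | yes a≈0 = trans (0^m (index 0#)) (sym a≈0)
    where
    0^m : ∀ {k} → Fin k → a ^ k ≈ 0#
    0^m {suc k} _ = trans (*-congʳ a≈0) (zeroˡ _)
  ... | no a≉0 = begin
    a ^ m                                  ≈⟨ ∏.sum-replicate m ⟨
    ∏.sum {m} (λ _ → a)                    ≈⟨ ∏.sum-cong-≋ (λ i → κ*μ≈a (element i)) ⟨
    ∏.sum (λ i → κ (element i) * μ (element i)) ≈⟨ ∏.∑-distrib-+ (κ ∘ element) (μ ∘ element) ⟩
    ∏.sum (κ ∘ element) * ∏.sum (μ ∘ element)   ≈⟨ *-cong ∏κ≈1 ∏μ≈a ⟩
    1# * a                                 ≈⟨ *-identityˡ a ⟩
    a                                      ∎
    where
    open ≈-Reasoning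

    ifZero : Carrier → Carrier → Carrier → Carrier
    ifZero y z x with x ≟ 0#
    ... | yes _ = y
    ... | no  _ = z

    ifZero-yes : ∀ {y z x} → x ≈ 0# → ifZero y z x ≈ y
    ifZero-yes {x = x} x≈0 with x ≟ 0#
    ... | yes _   = refl
    ... | no  x≉0 = contradiction x≈0 x≉0

    ifZero-no : ∀ {y z x} → x ≉ 0# → ifZero y z x ≈ z
    ifZero-no {x = x} x≉0 with x ≟ 0#
    ... | yes x≈0 = contradiction x≈0 x≉0
    ... | no  _   = refl

    -- `κ x` is the factor between `g x` and `g (a * x)`, which is 1 rather than `a` at zero. `μ`
    -- supplies the factor missing there, so that `κ` and `μ` multiply to `a` everywhere and aᵐ
    -- splits into the product of `κ`, which is 1, and that of `μ`, which is `a`.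
    g κ μ : Carrier → Carrier
    g x = ifZero 1# x x
    κ = ifZero 1# a
    μ = ifZero a 1#

    g-cong : Congruent _≈_ _≈_ g
    g-cong {x} {y} x≈y = by (x ≟ 0#)
      where
      by : Dec (x ≈ 0#) → g x ≈ g y
      by (yes x≈0) = trans (ifZero-yes x≈0) (sym (ifZero-yes (trans (sym x≈y) x≈0)))
      by (no  x≉0) = trans (ifZero-no x≉0) (trans x≈y (sym (ifZero-no (x≉0 ∘ trans x≈y))))

    g≉0 : ∀ x → g x ≉ 0#
    g≉0 x = by (x ≟ 0#)
      where
      by : Dec (x ≈ 0#) → g x ≉ 0#
      by (yes x≈0) eq = 1≉0 (trans (sym (ifZero-yes x≈0)) eq)
      by (no  x≉0) eq = x≉0 (trans (sym (ifZero-no x≉0)) eq)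

    g[a*x]≈κ*g : ∀ x → g (a * x) ≈ κ x * g x
    g[a*x]≈κ*g x = by (x ≟ 0#)
      where
      by : Dec (x ≈ 0#) → g (a * x) ≈ κ x * g x
      by (yes x≈0) = trans (ifZero-yes (trans (*-congˡ x≈0) (zeroʳ a)))
        (sym (trans (*-cong (ifZero-yes x≈0) (ifZero-yes x≈0)) (*-identityˡ 1#)))
      by (no  x≉0) = trans (ifZero-no (x*y≉0 a≉0 x≉0))
        (sym (*-cong (ifZero-no x≉0) (ifZero-no x≉0)))

    κ*μ≈a : ∀ x → κ x * μ x ≈ a
    κ*μ≈a x = by (x ≟ 0#)
      where
      by : Dec (x ≈ 0#) → κ x * μ x ≈ a
      by (yes x≈0) = trans (*-cong (ifZero-yes x≈0) (ifZero-yes x≈0)) (*-identityˡ a)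
      by (no  x≉0) = trans (*-cong (ifZero-no x≉0) (ifZero-no x≉0)) (*-identityʳ a)

    a⁻¹*[a*x] : ∀ x → a ⁻¹ * (a * x) ≈ x
    a⁻¹*[a*x] x = begin
      a ⁻¹ * (a * x)   ≈⟨ solve 3 (λ a z x → z :* (a :* x) := (a :* z) :* x) refl a (a ⁻¹) x ⟩
      (a * a ⁻¹) * x   ≈⟨ *-congʳ (*-inverseʳ a a≉0) ⟩
      1# * x           ≈⟨ *-identityˡ x ⟩
      x                ∎

    a*[a⁻¹*x] : ∀ x → a * (a ⁻¹ * x) ≈ x
    a*[a⁻¹*x] x = trans (x*[y*z]≈y*[x*z] a (a ⁻¹) x) (a⁻¹*[a*x] x)
      where
      x*[y*z]≈y*[x*z] = solve 3 (λ x y z → x :* (y :* z) := y :* (x :* z)) refl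

    ∏κ≈1 : ∏.sum (κ ∘ element) ≈ 1#
    ∏κ≈1 = *-cancelʳ-≉0 (product≉0 (g ∘ element) (g≉0 ∘ element)) (begin
      ∏.sum (κ ∘ element) * ∏.sum (g ∘ element)     ≈⟨ ∏.∑-distrib-+ (κ ∘ element) (g ∘ element) ⟨
      ∏.sum (λ i → κ (element i) * g (element i))   ≈⟨ ∏.sum-cong-≋ (λ i → g[a*x]≈κ*g (element i)) ⟨
      ∏.sum (λ i → g (a * element i))               ≈⟨ sum-reindex *-commutativeMonoid g g-cong *-congˡ *-congˡ
                                                         a*[a⁻¹*x] a⁻¹*[a*x] ⟨
      ∏.sum (g ∘ element)                           ≈⟨ *-identityˡ _ ⟨
      1# * ∏.sum (g ∘ element)                      ∎)

    ∏μ≈a : ∏.sum (μ ∘ element) ≈ a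
    ∏μ≈a = trans
      (product-single (μ ∘ element) (index 0#) λ j j≢0 →
        ifZero-no λ ej≈0 → j≢0 (≡.trans (≡.sym (index-element j)) (index-cong ej≈0)))
      (ifZero-yes (element-index 0#))

  -- Dividing out the first root lowers the degree by one and keeps the others as roots, because the
  -- linear factor is nonzero at them.
  roots⇒≈0 : ∀ d u (r : Fin d → Carrier) → Injective _≡_ _≈_ r →
             (∀ i → eval u (r i) ≈ 0#) → DegreeBelow d u → u ≈ₚ 0ₚ
  roots⇒≈0 zero    u r r-inj u[r]≈0 deg = DegreeBelow-0 deg
  roots⇒≈0 (suc d) u r r-inj u[r]≈0 deg with factor-root u (r zero) (u[r]≈0 zero)
  ... | s , u≈s[X-r₀] = Pₚ.trans u≈s[X-r₀] (*ₚ-cong {s} s≈0 (Pₚ.refl {X-r₀}))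
    where
    X-r₀ = X -ₚ C (r zero)

    s-root : ∀ i → eval s (r (suc i)) ≈ 0#
    s-root i = x*y≈0⇒y≈0
      (λ eq → contradiction (r-inj (x-y≈0⇒x≈y _ _ (trans (sym (eval-X-C (r zero) _)) eq))) λ ())
      (begin
        eval X-r₀ (r (suc i)) * eval s (r (suc i))    ≈⟨ *-comm _ _ ⟩
        eval s (r (suc i)) * eval X-r₀ (r (suc i))    ≈⟨ eval-* s X-r₀ (r (suc i)) ⟨
        eval (s *ₚ X-r₀) (r (suc i))                  ≈⟨ eval-cong u≈s[X-r₀] (r (suc i)) ⟨
        eval u (r (suc i))                            ≈⟨ u[r]≈0 (suc i) ⟩
        0#                                            ∎)
      where open ≈-Reasoning

    s≈0 : s ≈ₚ 0ₚ
    s≈0 = roots⇒≈0 d s (r ∘ suc) (Fin.suc-injective ∘ r-inj) s-root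
      (degree-factor 1 (monic-X-C (r zero)) d s
        (≡.subst (λ e → DegreeBelow e (s *ₚ X-r₀)) (≡.sym (ℕ.+-comm d 1)) (DegreeBelow-resp u≈s[X-r₀] deg)))

  -- Euclid's algorithm, Bézout coefficients and reduced inverses.

  record Gcd (u v : Poly) : Set (c ⊔ ℓ) where
    field
      gcd    : Poly
      gcd∣u  : gcd ∣ₚ u
      gcd∣v  : gcd ∣ₚ v
      a b    : Poly
      bézout : gcd ≈ₚ a *ₚ u +ₚ b *ₚ v

  -- The recursion is on a bound for the degree of `v`, not on the degree. If the top coefficient is
  -- zero, the bound is lowered; otherwise `v` is rescaled to the monic `v′`, by which `u` can be
  -- divided, and the remainder meets the smaller bound.
  euclid : ∀ d u v → DegreeBelow d v → Gcd u v
  euclid zero u v deg = record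
    { gcd    = u
    ; gcd∣u  = 1ₚ , Pₚ.*-identityˡ u
    ; gcd∣v  = 0ₚ , Pₚ.sym (DegreeBelow-0 deg)
    ; a      = 1ₚ
    ; b      = 0ₚ
    ; bézout = Pₚ.sym (Pₚ.trans (Pₚ.+-identityʳ _) (Pₚ.*-identityˡ u))
    }
  euclid (suc d) u v deg with coeff v d ≟ 0#
  ... | yes v_d≈0 = euclid d u v λ i d≤i → below (ℕ.m≤n⇒m<n∨m≡n d≤i)
    where
    below : ∀ {i} → d ℕ.< i ⊎ d ≡ i → coeff v i ≈ 0#
    below (inj₁ d<i)    = deg _ d<i
    below (inj₂ ≡.refl) = v_d≈0
  ... | no v_d≉0 = record
    { gcd    = g
    ; gcd∣u  = s *ₚ x +ₚ 1ₚ *ₚ y ,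
        Pₚ.bézout-∣ {x} {g} {v′} {y} {r} {s} {1ₚ} x*g≈v′ y*g≈r
          (Pₚ.sym (Pₚ.trans u≈s*v′+r (+ₚ-congˡ (s *ₚ v′) (Pₚ.sym (Pₚ.*-identityˡ r)))))
    ; gcd∣v  = C l *ₚ x , (begin
        C l *ₚ x *ₚ g             ≈⟨ Pₚ.*-assoc (C l) x g ⟩
        C l *ₚ (x *ₚ g)           ≈⟨ *ₚ-congˡ (C l) x*g≈v′ ⟩
        C l *ₚ v′                 ≈⟨ C-* l v′ ⟩
        scale l (scale (l ⁻¹) v)  ≈⟨ scale-scale l (l ⁻¹) v ⟨
        scale (l * l ⁻¹) v        ≈⟨ scale-cong (*-inverseʳ l v_d≉0) Pₚ.refl ⟩
        scale 1# v                ≈⟨ scale-1 v ⟩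
        v                         ∎)
    ; a      = b
    ; b      = (a -ₚ b *ₚ s) *ₚ C (l ⁻¹)
    ; bézout = Pₚ.sym (begin
        b *ₚ u +ₚ (a -ₚ b *ₚ s) *ₚ C (l ⁻¹) *ₚ v
          ≈⟨ +ₚ-congˡ (b *ₚ u) (Pₚ.trans (Pₚ.*-assoc (a -ₚ b *ₚ s) (C (l ⁻¹)) v)
               (*ₚ-congˡ (a -ₚ b *ₚ s) (C-* (l ⁻¹) v))) ⟩
        b *ₚ u +ₚ (a -ₚ b *ₚ s) *ₚ v′   ≈⟨ Pₚ.euclid-step {u} {s} {v′} {r} a b u≈s*v′+r ⟩
        a *ₚ v′ +ₚ b *ₚ r               ≈⟨ bézout ⟨
        g                               ∎)
    }
    where
    open Pₚ.≈-Reasoning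
    l = coeff v d
    v′ = scale (l ⁻¹) v
    monic : Monic d v′
    monic = trans (coeff-scale (l ⁻¹) v d) (trans (*-comm _ _) (*-inverseʳ l v_d≉0))
          , DegreeBelow-scale {u = v} (l ⁻¹) deg
    division = divide monic u
    s = proj₁ division
    r = proj₁ (proj₂ division)
    u≈s*v′+r = proj₁ (proj₂ (proj₂ division))
    open Gcd (euclid d v′ r (proj₂ (proj₂ (proj₂ division)))) renaming (gcd to g; gcd∣u to g∣v′; gcd∣v to g∣r)
    x = _∣ʳ_.quotient g∣v′
    y = _∣ʳ_.quotient g∣r
    x*g≈v′ = _∣ʳ_.equality g∣v′
    y*g≈r = _∣ʳ_.equality g∣r

  -- `Coprimeₚ` speaks only of common divisors. Applied to the gcd of Euclid's algorithm it makes
  -- that gcd a unit, and the Bézout identity is multiplied by its inverse `w`.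
  coprime⇒bézout : ∀ u v → Coprimeₚ u v → ∃₂ λ a b → a *ₚ u +ₚ b *ₚ v ≈ₚ 1ₚ
  coprime⇒bézout u v coprime with euclid (length v) u v (DegreeBelow-length v)
  ... | G with coprime (Gcd.gcd∣u G) (Gcd.gcd∣v G)
  ...   | w , w*g≈1 = w *ₚ a , w *ₚ b , (begin
    w *ₚ a *ₚ u +ₚ w *ₚ b *ₚ v       ≈⟨ Pₚ.+-cong (Pₚ.*-assoc w a u) (Pₚ.*-assoc w b v) ⟩
    w *ₚ (a *ₚ u) +ₚ w *ₚ (b *ₚ v)   ≈⟨ Pₚ.distribˡ w (a *ₚ u) (b *ₚ v) ⟨
    w *ₚ (a *ₚ u +ₚ b *ₚ v)          ≈⟨ *ₚ-congˡ w bézout ⟨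
    w *ₚ gcd                         ≈⟨ w*g≈1 ⟩
    1ₚ                               ∎)
    where
    open Gcd G
    open Pₚ.≈-Reasoning

  bézout⇒coprime : ∀ u v a b → a *ₚ u +ₚ b *ₚ v ≈ₚ 1ₚ → Coprimeₚ u v
  bézout⇒coprime u v a b eq {z} (x , x*z≈u) (y , y*z≈v) =
    a *ₚ x +ₚ b *ₚ y , Pₚ.bézout-∣ {x} {z} {u} {y} {v} {a} {b} x*z≈u y*z≈v eq

  ≅1⇒≈ : ∀ u m → u ≅ 1ₚ [modₚ m ] → ∃ λ w → u ≈ₚ w *ₚ m +ₚ 1ₚ
  ≅1⇒≈ u m (w , w*m≈u-1) = w , Pₚ.x-y≈z⇒x≈z+y {u} {1ₚ} (Pₚ.sym w*m≈u-1)

  monic-cancel : ∀ {d m} → Monic d m → ∀ u → DegreeBelow d (u *ₚ m) → u ≈ₚ 0ₚ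
  monic-cancel {d} monic u deg = DegreeBelow-0 (degree-factor d monic 0 u deg)

  -- The inverse is a Bézout coefficient of `h` reduced modulo `m`. Two reduced inverses differ by a
  -- multiple of `m` of degree below that of `m`, hence by zero.
  reducedInverse : ∀ {d m} h → Monic d m → Coprimeₚ h m → ∃! _≈ₚ_ (ReducedInverse h m d)
  reducedInverse {d} {m} h monic coprime with coprime⇒bézout h m coprime
  ... | a , b , bézout with divide monic a
  ... | s , r , a≈s*m+r , deg-r =
    r , (deg-r , w , Pₚ.sym (Pₚ.x≈z+y⇒x-y≈z {h *ₚ r} {1ₚ} hr≈wm+1)) , unique
    where
    w = -ₚ (s *ₚ h +ₚ b)

    hr≈wm+1 : h *ₚ r ≈ₚ w *ₚ m +ₚ 1ₚ
    hr≈wm+1 = Pₚ.bézout-remainder {a} {h} {b} {m} {s} {r} bézout a≈s*m+r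

    unique : ∀ {H} → ReducedInverse h m d H → r ≈ₚ H
    unique {H} (deg-H , hH≅1) with ≅1⇒≈ (h *ₚ H) m hH≅1
    ... | x , hH≈xm+1 = Pₚ.x-y≈0⇒x≈y r H (Pₚ.trans r-H≈v*m (*ₚ-cong v≈0 (Pₚ.refl {m})))
      where
      v = w *ₚ H -ₚ x *ₚ r

      r-H≈v*m : r -ₚ H ≈ₚ v *ₚ m
      r-H≈v*m = Pₚ.inverses-congruent {h} {r} {w} {m} {H} {x} hr≈wm+1 hH≈xm+1

      v≈0 : v ≈ₚ 0ₚ
      v≈0 = monic-cancel monic v (DegreeBelow-resp r-H≈v*m
        (DegreeBelow-+ {u = r} deg-r (DegreeBelow-neg {u = H} deg-H)))

-- The characteristic and the additivity of p-th powers.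

module Characteristic {c ℓ p k m} (p-prime : Prime p) (m≡p^k : m ≡ p ℕ.^ k)
  (field′ : FiniteField c ℓ m) where

  open FiniteFieldTheory field′

  -- The k-th power of `p · 1#` is `m · 1#`, which is zero, and a field has no nilpotents.
  p·1≈0 : p · 1# ≈ 0#
  p·1≈0 = x^k≈0⇒x≈0 k (trans (sym (power k)) (trans (reflexive (≡.cong (_· 1#) (≡.sym m≡p^k))) m·1≈0))
    where
    power : ∀ k → (p ℕ.^ k) · 1# ≈ (p · 1#) ^ k
    power zero    = +-identityʳ 1#
    power (suc k) = trans (×1-homo-* p (p ℕ.^ k)) (*-congˡ (power k))

  p∣a⇒a·1≈0 : ∀ {a} → p ∣ a → a · 1# ≈ 0#
  p∣a⇒a·1≈0 {a} (divides b ≡.refl) = trans (×1-homo-* b p) (trans (*-congˡ p·1≈0) (zeroʳ _))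

  -- By Bézout in ℕ a multiple of one of `p`, `a` exceeds a multiple of the other by 1. If both were
  -- zero in the field, so would 1 be.
  p∤a⇒a·1≉0 : ∀ {a} → p ∤ a → a · 1# ≉ 0#
  p∤a⇒a·1≉0 {a} p∤a a·1≈0 = absurd (coprime-Bézout coprime)
    where
    coprime : Coprime p a
    coprime (d∣p , d∣a) with prime⇒irreducible p-prime d∣p
    ... | inj₁ d≡1    = d≡1
    ... | inj₂ ≡.refl = contradiction d∣a p∤a

    multiple : ∀ b {a} → a · 1# ≈ 0# → (b ℕ.* a) · 1# ≈ 0#
    multiple b {a} a≈0 = trans (×1-homo-* b a) (trans (*-congˡ a≈0) (zeroʳ _))

    impossible : ∀ {b c} → b · 1# ≈ 0# → c · 1# ≈ 0# → ¬ (1 ℕ.+ b ≡ c)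
    impossible {b} b≈0 c≈0 ≡.refl = 1≉0 (trans (sym (trans (+-congˡ b≈0) (+-identityʳ 1#))) c≈0)

    absurd : ¬ Bézout.Identity 1 p a
    absurd (Bézout.+- x y eq) = impossible (multiple y a·1≈0) (multiple x p·1≈0) eq
    absurd (Bézout.-+ x y eq) = impossible (multiple x p·1≈0) (multiple y a·1≈0) eq

  p∣a⇒a·x≈0 : ∀ {a} x → p ∣ a → a · x ≈ 0#
  p∣a⇒a·x≈0 {a} x p∣a = begin
    a · x           ≈⟨ ×-congʳ a (*-identityˡ x) ⟨
    a · (1# * x)    ≈⟨ ×-assoc-* a 1# x ⟨
    a · 1# * x      ≈⟨ *-congʳ (p∣a⇒a·1≈0 p∣a) ⟩
    0# * x          ≈⟨ zeroˡ x ⟩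
    0#              ∎
    where open ≈-Reasoning

  -- All binomial coefficients but the two outer ones are divisible by `p`.
  [x+y]^p≈x^p+y^p : ∀ x y → (x + y) ^ p ≈ x ^ p + y ^ p
  [x+y]^p≈x^p+y^p x y = begin
    (x + y) ^ p          ≈⟨ theorem p x y ⟩
    sum (binomialTerm x y p)
      ≈⟨ ends (binomialTerm x y p) (ℕ.>-nonZero⁻¹ p {{prime⇒nonZero p-prime}}) inner≈0 ⟩
    binomialTerm x y p zero + binomialTerm x y p (fromℕ p)
      ≈⟨ +-cong first last ⟩
    y ^ p + x ^ p        ≈⟨ +-comm _ _ ⟩
    x ^ p + y ^ p        ∎
    where
    open ≈-Reasoning
    open Binomial commutativeSemiring using (theorem; binomialTerm)
    open import Algebra.Properties.Monoid.Sum +-monoid using (sum-init-last; sum-replicate-zero)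

    inner≈0 : ∀ i → 1 ≤ toℕ i → toℕ i ℕ.< p → binomialTerm x y p i ≈ 0#
    inner≈0 i 1≤i i<p = p∣a⇒a·x≈0 _ (prime∣C p-prime 1≤i i<p)

    first : binomialTerm x y p zero ≈ y ^ p
    first = trans (+-identityʳ _) (*-identityˡ _)

    last : binomialTerm x y p (fromℕ p) ≈ x ^ p
    last rewrite Fin.toℕ-fromℕ p | nCn≡1 p | ℕ.n∸n≡0 p = trans (+-identityʳ _) (*-identityʳ _)

    ends : ∀ {k} (t : Fin (suc k) → Carrier) → 1 ≤ k →
           (∀ i → 1 ≤ toℕ i → toℕ i ℕ.< k → t i ≈ 0#) → sum t ≈ t zero + t (fromℕ k)
    ends {suc k} t _ t≈0 = +-congˡ (begin
      sum (t ∘ suc)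
        ≈⟨ sum-init-last (t ∘ suc) ⟩
      sum (t ∘ suc ∘ inject₁) + t (suc (fromℕ k))
        ≈⟨ +-congʳ (sum-cong-≋ λ i → t≈0 (suc (inject₁ i)) (s≤s z≤n)
             (s≤s (≡.subst (ℕ._< k) (≡.sym (Fin.toℕ-inject₁ i)) (Fin.toℕ<n i)))) ⟩
      sum {k} (λ _ → 0#) + t (suc (fromℕ k))
        ≈⟨ trans (+-congʳ (sum-replicate-zero k)) (+-identityˡ _) ⟩
      t (suc (fromℕ k)) ∎)

  [x+y]^p^e≈ : ∀ e x y → (x + y) ^ (p ℕ.^ e) ≈ x ^ (p ℕ.^ e) + y ^ (p ℕ.^ e)
  [x+y]^p^e≈ zero    x y = trans (*-identityʳ _) (sym (+-cong (*-identityʳ x) (*-identityʳ y)))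
  [x+y]^p^e≈ (suc e) x y = begin
    (x + y) ^ (p ℕ.* p ℕ.^ e)                        ≈⟨ ^-assocʳ (x + y) p (p ℕ.^ e) ⟨
    ((x + y) ^ p) ^ (p ℕ.^ e)                        ≈⟨ ^-congˡ (p ℕ.^ e) ([x+y]^p≈x^p+y^p x y) ⟩
    (x ^ p + y ^ p) ^ (p ℕ.^ e)                      ≈⟨ [x+y]^p^e≈ e (x ^ p) (y ^ p) ⟩
    (x ^ p) ^ (p ℕ.^ e) + (y ^ p) ^ (p ℕ.^ e)        ≈⟨ +-cong (^-assocʳ x p (p ℕ.^ e)) (^-assocʳ y p (p ℕ.^ e)) ⟩
    x ^ (p ℕ.* p ℕ.^ e) + y ^ (p ℕ.* p ℕ.^ e)        ∎
    where open ≈-Reasoning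

-- Polynomials over 𝔽_q acting on K through the Frobenius map, and the trace.

module FrobeniusOperators
  {c₁ ℓ₁ c₂ ℓ₂} {p q n e : ℕ} (p-prime : Prime p) (1≤e : 1 ≤ e) (q≡p^e : q ≡ p ℕ.^ e) (1≤n : 1 ≤ n)
  (F′ : FiniteField c₁ ℓ₁ q) (K′ : FiniteField c₂ ℓ₂ (q ℕ.^ n))
  (ι : FiniteField.Carrier F′ → FiniteField.Carrier K′)
  (ι-inclusion : Extension.IsInclusion q n F′ K′ ι)
  where

  module F = FiniteFieldTheory F′
  module F[x] = Polynomial F.commutativeRing
  open FiniteFieldTheory K′ public
  open Polynomial commutativeRing public
  open Extension q n F′ K′ ι public
  open ≈-Reasoning

  q^n≡p^[e*n] : q ℕ.^ n ≡ p ℕ.^ (e ℕ.* n)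
  q^n≡p^[e*n] = ≡.trans (≡.cong (ℕ._^ n) q≡p^e) (ℕ.^-*-assoc p e n)

  module CharF = Characteristic {k = e} p-prime q≡p^e F′
  module CharK = Characteristic {k = e ℕ.* n} p-prime q^n≡p^[e*n] K′

  1<q : 1 ℕ.< q
  1<q = ≡.subst (1 ℕ.<_) (≡.sym q≡p^e)
    (ℕ.<-≤-trans (ℕ.nonTrivial⇒n>1 p {{prime⇒nonTrivial p-prime}})
      (≡.subst (ℕ._≤ p ℕ.^ e) (ℕ.*-identityʳ p) (ℕ.^-monoʳ-≤ p {{prime⇒nonZero p-prime}} 1≤e)))

  q^<q^ : ∀ {i j} → i ℕ.< j → q ℕ.^ i ℕ.< q ℕ.^ j
  q^<q^ = ℕ.^-monoʳ-< q 1<q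

  open RingMorphisms.IsRingMonomorphism ι-inclusion public
    using ()
    renaming (⟦⟧-cong to ι-cong; +-homo to ι-+; *-homo to ι-*; -‿homo to ι-neg;
              0#-homo to ι-0; 1#-homo to ι-1; injective to ι-injective)

  ι-^ : ∀ a k → ι (a F.^ k) ≈ ι a ^ k
  ι-^ a zero    = ι-1
  ι-^ a (suc k) = trans (ι-* a _) (*-congˡ (ι-^ a k))

  ι≈0 : ∀ {a} → ι a ≈ 0# → a F.≈ F.0#
  ι≈0 ιa≈0 = ι-injective (trans ιa≈0 (sym ι-0))

  ι≉0 : ∀ {a} → a F.≉ F.0# → ι a ≉ 0#
  ι≉0 a≉0 = a≉0 ∘ ι≈0

  eval-embed : ∀ u a → eval (embed u) (ι a) ≈ ι (F[x].eval u a)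
  eval-embed []      a = sym ι-0
  eval-embed (b ∷ u) a = begin
    ι b + ι a * eval (embed u) (ι a)     ≈⟨ +-congˡ (*-congˡ (eval-embed u a)) ⟩
    ι b + ι a * ι (F[x].eval u a)        ≈⟨ +-congˡ (ι-* a _) ⟨
    ι b + ι (a F.* F[x].eval u a)        ≈⟨ ι-+ b _ ⟨
    ι (b F.+ a F.* F[x].eval u a)        ∎

  φ : Carrier → Carrier
  φ = _^ q

  φ-cong : Congruent _≈_ _≈_ φ
  φ-cong = ^-congˡ q

  φ-+ : ∀ x y → φ (x + y) ≈ φ x + φ y
  φ-+ = ≡.subst (λ k → ∀ x y → (x + y) ^ k ≈ x ^ k + y ^ k) (≡.sym q≡p^e) (CharK.[x+y]^p^e≈ e)

  φ-* : ∀ x y → φ (x * y) ≈ φ x * φ y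
  φ-* x y = ^-distrib-* x y q

  Fixed : Carrier → Set ℓ₂
  Fixed x = φ x ≈ x

  ι-fixed : ∀ a → Fixed (ι a)
  ι-fixed a = trans (sym (ι-^ a q)) (ι-cong (F.x^m≈x a))

  φ-0 : Fixed 0#
  φ-0 = trans (φ-cong (sym ι-0)) (trans (ι-fixed F.0#) ι-0)

  -- The function induced by `L u`, made recursive in `u`: a factor x in front of a polynomial
  -- becomes an application of `φ` to the argument. `L u` is a sum over indices and does not lend
  -- itself to induction on `u`.
  ℒ : F[x].Poly → Carrier → Carrier
  ℒ []      y = 0#
  ℒ (a ∷ u) y = ι a * y + ℒ u (φ y)

  private
    y^q^ : ∀ y j → φ y ^ (q ℕ.^ j) ≈ y ^ (q ℕ.^ suc j)
    y^q^ y j = ^-assocʳ y q (q ℕ.^ j)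

  ℒ-congʳ : ∀ u {x y} → x ≈ y → ℒ u x ≈ ℒ u y
  ℒ-congʳ []      x≈y = refl
  ℒ-congʳ (a ∷ u) x≈y = +-cong (*-congˡ x≈y) (ℒ-congʳ u (φ-cong x≈y))

  eval-L : ∀ u y → eval (L u) y ≈ ℒ u y
  eval-L u y = trans
    (eval-sum (λ i → C (lookup (embed u) i) *ₚ X ^ₚ (q ℕ.^ toℕ i)) y)
    (trans (sum-cong-≋ {length (embed u)} (λ i → trans
        (eval-* (C (lookup (embed u) i)) (X ^ₚ (q ℕ.^ toℕ i)) y)
        (*-cong (eval-C _ y) (eval-X^ (q ℕ.^ toℕ i) y))))
      (powers u y))
    where
    powers : ∀ u y → sum (λ i → lookup (embed u) i * y ^ (q ℕ.^ toℕ i)) ≈ ℒ u y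
    powers []      y = refl
    powers (a ∷ u) y = +-cong (*-congˡ (*-identityʳ y))
      (trans (sum-cong-≋ {length (embed u)} (λ i → *-congˡ (sym (y^q^ y (toℕ i))))) (powers u (φ y)))

  E : F[x].Poly
  E = F[x].[Xⁿ-1]/[X-1] n

  xⁿ-1 : F[x].Poly
  xⁿ-1 = F[x].X F[x].^ₚ n F[x].-ₚ F[x].1ₚ

  monic-E : F.Monic (n ∸ 1) E
  monic-E = F.monic-[Xⁿ-1]/[X-1] 1≤n

  monic-xⁿ-1 : F.Monic n xⁿ-1
  monic-xⁿ-1 = F.monic-X^-u (F.DegreeBelow-mono {u = F[x].1ₚ} 1≤n (F.DegreeBelow-length F[x].1ₚ))

  tr : Carrier → Carrier
  tr = ℒ E

  eval-Tr : ∀ y → eval Tr y ≈ tr y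
  eval-Tr y = trans (eval-sum {n} (λ i → X ^ₚ (q ℕ.^ toℕ i)) y)
    (trans (sum-cong-≋ {n} (λ i → eval-X^ (q ℕ.^ toℕ i) y)) (powers n y))
    where
    powers : ∀ k y → sum {k} (λ i → y ^ (q ℕ.^ toℕ i)) ≈ ℒ (F[x].[Xⁿ-1]/[X-1] k) y
    powers zero    y = refl
    powers (suc k) y = +-cong
      (trans (*-identityʳ y) (sym (trans (*-congʳ ι-1) (*-identityˡ y))))
      (trans (sum-cong-≋ {k} (λ i → sym (y^q^ y (toℕ i)))) (powers k (φ y)))

  ℒ-cong : ∀ u v → u F[x].≈ₚ v → ∀ y → ℒ u y ≈ ℒ v y
  ℒ-cong u v u≈v y with u | v | F[x].coeff-≈ u≈v
  ... | []     | []     | eq = refl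
  ... | []     | b ∷ v′ | eq = begin
    0#                        ≈⟨ trans (+-congʳ (zeroˡ y)) (+-identityˡ 0#) ⟨
    0# * y + 0#               ≈⟨ +-cong (*-congʳ (trans (sym ι-0) (ι-cong (eq 0)))) (ℒ-cong [] v′ (F[x].coeffwise (eq ∘ suc)) (φ y)) ⟩
    ι b * y + ℒ v′ (φ y)      ∎
  ... | a ∷ u′ | []     | eq = begin
    ι a * y + ℒ u′ (φ y)      ≈⟨ +-cong (*-congʳ (trans (ι-cong (eq 0)) ι-0)) (ℒ-cong u′ [] (F[x].coeffwise (eq ∘ suc)) (φ y)) ⟩
    0# * y + 0#               ≈⟨ trans (+-congʳ (zeroˡ y)) (+-identityˡ 0#) ⟩
    0#                        ∎
  ... | a ∷ u′ | b ∷ v′ | eq =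
    +-cong (*-congʳ (ι-cong (eq 0))) (ℒ-cong u′ v′ (F[x].coeffwise (eq ∘ suc)) (φ y))

  ℒ-additive : ∀ u x y → ℒ u (x + y) ≈ ℒ u x + ℒ u y
  ℒ-additive []      x y = sym (+-identityˡ 0#)
  ℒ-additive (a ∷ u) x y = begin
    ι a * (x + y) + ℒ u (φ (x + y))
      ≈⟨ +-cong (distribˡ (ι a) x y) (trans (ℒ-congʳ u (φ-+ x y)) (ℒ-additive u (φ x) (φ y))) ⟩
    (ι a * x + ι a * y) + (ℒ u (φ x) + ℒ u (φ y))
      ≈⟨ +-interchange (ι a * x) (ι a * y) (ℒ u (φ x)) (ℒ u (φ y)) ⟩
    (ι a * x + ℒ u (φ x)) + (ι a * y + ℒ u (φ y)) ∎

  -- The scalar is only required to be fixed by `φ`, so that traces and values at traces can be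
  -- pulled out without first naming their preimages under `ι`.
  ℒ-homogeneous : ∀ u {c} y → Fixed c → ℒ u (c * y) ≈ c * ℒ u y
  ℒ-homogeneous []      {c} y φc≈c = sym (zeroʳ c)
  ℒ-homogeneous (a ∷ u) {c} y φc≈c = begin
    ι a * (c * y) + ℒ u (φ (c * y))
      ≈⟨ +-cong (x*[y*z]≈y*[x*z] (ι a) c y)
                (trans (ℒ-congʳ u (trans (φ-* c y) (*-congʳ φc≈c))) (ℒ-homogeneous u (φ y) φc≈c)) ⟩
    c * (ι a * y) + c * ℒ u (φ y)   ≈⟨ distribˡ c _ _ ⟨
    c * (ι a * y + ℒ u (φ y))       ∎
    where x*[y*z]≈y*[x*z] = solve 3 (λ x y z → x :* (y :* z) := y :* (x :* z)) refl

  ℒ-0 : ∀ u → ℒ u 0# ≈ 0#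
  ℒ-0 u = trans (ℒ-congʳ u (sym (zeroˡ 0#))) (trans (ℒ-homogeneous u 0# φ-0) (zeroˡ _))

  ℒ-minus : ∀ u x y → ℒ u (x - y) ≈ ℒ u x - ℒ u y
  ℒ-minus u x y = sym (x≈z+y⇒x-y≈z (begin
    ℒ u x                   ≈⟨ ℒ-congʳ u (x-y≈z⇒x≈z+y refl) ⟩
    ℒ u (x - y + y)         ≈⟨ ℒ-additive u (x - y) y ⟩
    ℒ u (x - y) + ℒ u y     ∎))

  -- The coefficients come from 𝔽_q and are thus fixed by `φ`.
  ℒ-φ : ∀ u y → ℒ u (φ y) ≈ φ (ℒ u y)
  ℒ-φ []      y = sym φ-0
  ℒ-φ (a ∷ u) y = begin
    ι a * φ y + ℒ u (φ (φ y))      ≈⟨ +-cong (*-congʳ (sym (ι-fixed a))) (ℒ-φ u (φ y)) ⟩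
    φ (ι a) * φ y + φ (ℒ u (φ y))  ≈⟨ +-congʳ (φ-* (ι a) y) ⟨
    φ (ι a * y) + φ (ℒ u (φ y))    ≈⟨ φ-+ _ _ ⟨
    φ (ι a * y + ℒ u (φ y))        ∎

  ℒ-+ : ∀ u v y → ℒ (u F[x].+ₚ v) y ≈ ℒ u y + ℒ v y
  ℒ-+ []      v       y = sym (+-identityˡ _)
  ℒ-+ (a ∷ u) []      y = sym (+-identityʳ _)
  ℒ-+ (a ∷ u) (b ∷ v) y = begin
    ι (a F.+ b) * y + ℒ (u F[x].+ₚ v) (φ y)
      ≈⟨ +-cong (trans (*-congʳ (ι-+ a b)) (distribʳ y (ι a) (ι b))) (ℒ-+ u v (φ y)) ⟩
    (ι a * y + ι b * y) + (ℒ u (φ y) + ℒ v (φ y))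
      ≈⟨ +-interchange (ι a * y) (ι b * y) (ℒ u (φ y)) (ℒ v (φ y)) ⟩
    (ι a * y + ℒ u (φ y)) + (ι b * y + ℒ v (φ y)) ∎

  ℒ-scale : ∀ a u y → ℒ (F.scale a u) y ≈ ι a * ℒ u y
  ℒ-scale a []      y = sym (zeroʳ _)
  ℒ-scale a (b ∷ u) y = begin
    ι (a F.* b) * y + ℒ (F.scale a u) (φ y)    ≈⟨ +-cong (trans (*-congʳ (ι-* a b)) (*-assoc _ _ _)) (ℒ-scale a u (φ y)) ⟩
    ι a * (ι b * y) + ι a * ℒ u (φ y)          ≈⟨ distribˡ _ _ _ ⟨
    ι a * (ι b * y + ℒ u (φ y))                ∎

  ℒ-shift : ∀ u y → ℒ (F.shift u) y ≈ ℒ u (φ y)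
  ℒ-shift u y = trans (+-congʳ (trans (*-congʳ ι-0) (zeroˡ y))) (+-identityˡ _)

  -- The operators commute with `φ`, so the product of polynomials turns into composition; the
  -- commutativity of all these operators is inherited from the polynomial ring.
  ℒ-* : ∀ u v y → ℒ (u F[x].*ₚ v) y ≈ ℒ u (ℒ v y)
  ℒ-* []      v y = refl
  ℒ-* (a ∷ u) v y = begin
    ℒ (F.scale a v F[x].+ₚ F.shift (u F[x].*ₚ v)) y         ≈⟨ ℒ-+ (F.scale a v) (F.shift (u F[x].*ₚ v)) y ⟩
    ℒ (F.scale a v) y + ℒ (F.shift (u F[x].*ₚ v)) y         ≈⟨ +-cong (ℒ-scale a v y) (ℒ-shift (u F[x].*ₚ v) y) ⟩
    ι a * ℒ v y + ℒ (u F[x].*ₚ v) (φ y)                     ≈⟨ +-congˡ (trans (ℒ-* u v (φ y)) (ℒ-congʳ u (ℒ-φ v y))) ⟩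
    ι a * ℒ v y + ℒ u (φ (ℒ v y))                           ∎

  ℒ-comm : ∀ u v y → ℒ u (ℒ v y) ≈ ℒ v (ℒ u y)
  ℒ-comm u v y = begin
    ℒ u (ℒ v y)           ≈⟨ ℒ-* u v y ⟨
    ℒ (u F[x].*ₚ v) y     ≈⟨ ℒ-cong _ _ (F.*ₚ-comm u v) y ⟩
    ℒ (v F[x].*ₚ u) y     ≈⟨ ℒ-* v u y ⟩
    ℒ v (ℒ u y)           ∎

  ℒ-1 : ∀ y → ℒ F[x].1ₚ y ≈ y
  ℒ-1 y = trans (+-identityʳ _) (trans (*-congʳ ι-1) (*-identityˡ y))

  ℒ-subtract : ∀ u v y → ℒ (u F[x].-ₚ v) y + ℒ v y ≈ ℒ u y
  ℒ-subtract u v y = trans (sym (ℒ-+ (u F[x].-ₚ v) v y))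
    (ℒ-cong _ u (F.Pₚ.sym (F.Pₚ.x-y≈z⇒x≈z+y {u} {v} F.Pₚ.refl)) y)

  -- On fixed elements `φ` acts as 1, so the polynomial acts through its value there. This is where
  -- h(1) in Q and w(1) in the inverse come from.
  ℒ-fixed : ∀ u {c} → Fixed c → ℒ u c ≈ ι (F[x].eval u F.1#) * c
  ℒ-fixed []      {c} φc≈c = sym (trans (*-congʳ ι-0) (zeroˡ c))
  ℒ-fixed (a ∷ u) {c} φc≈c = begin
    ι a * c + ℒ u (φ c)                         ≈⟨ +-congˡ (trans (ℒ-congʳ u φc≈c) (ℒ-fixed u φc≈c)) ⟩
    ι a * c + ι (F[x].eval u F.1#) * c          ≈⟨ distribʳ c _ _ ⟨
    (ι a + ι (F[x].eval u F.1#)) * c            ≈⟨ *-congʳ (+-congˡ (ι-cong (F.*-identityˡ _))) ⟨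
    (ι a + ι (F.1# F.* F[x].eval u F.1#)) * c   ≈⟨ *-congʳ (ι-+ a _) ⟨
    ι (a F.+ F.1# F.* F[x].eval u F.1#) * c     ∎

  ℒ-X^ : ∀ k y → ℒ (F[x].X F[x].^ₚ k) y ≈ y ^ (q ℕ.^ k)
  ℒ-X^ zero    y = trans (ℒ-1 y) (sym (*-identityʳ y))
  ℒ-X^ (suc k) y = begin
    ℒ (F[x].X F[x].*ₚ F[x].X F[x].^ₚ k) y     ≈⟨ ℒ-cong _ _ (F.X* (F[x].X F[x].^ₚ k)) y ⟩
    ℒ (F.shift (F[x].X F[x].^ₚ k)) y          ≈⟨ ℒ-shift (F[x].X F[x].^ₚ k) y ⟩
    ℒ (F[x].X F[x].^ₚ k) (φ y)                ≈⟨ ℒ-X^ k (φ y) ⟩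
    φ y ^ (q ℕ.^ k)                           ≈⟨ y^q^ y k ⟩
    y ^ (q ℕ.^ suc k)                         ∎

  ℒ-xⁿ-1 : ∀ y → ℒ xⁿ-1 y ≈ 0#
  ℒ-xⁿ-1 y = +-cancelʳ y _ _ (begin
    ℒ xⁿ-1 y + y                   ≈⟨ +-congˡ (ℒ-1 y) ⟨
    ℒ xⁿ-1 y + ℒ F[x].1ₚ y         ≈⟨ ℒ-subtract (F[x].X F[x].^ₚ n) F[x].1ₚ y ⟩
    ℒ (F[x].X F[x].^ₚ n) y         ≈⟨ ℒ-X^ n y ⟩
    y ^ (q ℕ.^ n)                  ≈⟨ x^m≈x y ⟩
    y                              ≈⟨ +-identityˡ y ⟨
    0# + y                         ∎)

  -- The operator of x - 1 sends y to φ y - y, and (x - 1)E = xⁿ - 1 acts as zero.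
  tr-fixed : ∀ y → Fixed (tr y)
  tr-fixed y = begin
    φ (tr y)                                    ≈⟨ trans (ℒ-shift F[x].1ₚ (tr y)) (ℒ-1 (φ (tr y))) ⟨
    ℒ F[x].X (tr y)                             ≈⟨ ℒ-subtract F[x].X F[x].1ₚ (tr y) ⟨
    ℒ (F[x].X F[x].-ₚ F[x].1ₚ) (tr y) + ℒ F[x].1ₚ (tr y)
                                                ≈⟨ +-cong (ℒ-* (F[x].X F[x].-ₚ F[x].1ₚ) E y) (sym (ℒ-1 (tr y))) ⟨
    ℒ ((F[x].X F[x].-ₚ F[x].1ₚ) F[x].*ₚ E) y + tr y
                                                ≈⟨ +-congʳ (ℒ-cong _ _ (F[x].[X-1]*[Xⁿ-1]/[X-1] n) y) ⟩
    ℒ xⁿ-1 y + tr y                             ≈⟨ +-congʳ (ℒ-xⁿ-1 y) ⟩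
    0# + tr y                                   ≈⟨ +-identityˡ _ ⟩
    tr y                                        ∎

  -- The q-associate of xʲ u, which unlike L u itself is recursive in u.  Its coefficients are those
  -- of u, since the exponents q^i are distinct.
  shiftedAssociate : ℕ → F[x].Poly → Poly
  shiftedAssociate j []      = 0ₚ
  shiftedAssociate j (a ∷ u) = C (ι a) *ₚ X ^ₚ (q ℕ.^ j) +ₚ shiftedAssociate (suc j) u

  eval-shiftedAssociate : ∀ j u y → eval (shiftedAssociate j u) y ≈ ℒ u (y ^ (q ℕ.^ j))
  eval-shiftedAssociate j []      y = refl
  eval-shiftedAssociate j (a ∷ u) y = begin
    eval (C (ι a) *ₚ X ^ₚ (q ℕ.^ j) +ₚ shiftedAssociate (suc j) u) y
      ≈⟨ eval-+ (C (ι a) *ₚ X ^ₚ (q ℕ.^ j)) (shiftedAssociate (suc j) u) y ⟩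
    eval (C (ι a) *ₚ X ^ₚ (q ℕ.^ j)) y + eval (shiftedAssociate (suc j) u) y
      ≈⟨ +-cong (trans (eval-* (C (ι a)) (X ^ₚ (q ℕ.^ j)) y) (*-cong (eval-C _ y) (eval-X^ (q ℕ.^ j) y)))
                (eval-shiftedAssociate (suc j) u y) ⟩
    ι a * y ^ (q ℕ.^ j) + ℒ u (y ^ (q ℕ.* q ℕ.^ j))
      ≈⟨ +-congˡ (ℒ-congʳ u (trans (^-congʳ y (ℕ.*-comm q (q ℕ.^ j))) (sym (^-assocʳ y (q ℕ.^ j) q)))) ⟩
    ι a * y ^ (q ℕ.^ j) + ℒ u (φ (y ^ (q ℕ.^ j))) ∎

  private
    coeff-CX^ : ∀ c k i → coeff (C c *ₚ X ^ₚ k) i ≈ c * coeff (X ^ₚ k) i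
    coeff-CX^ c k i = trans (coeff-≈ (C-* c (X ^ₚ k)) i) (coeff-scale c (X ^ₚ k) i)

    coeff-CX^-≢ : ∀ c k i → i ≢ k → coeff (C c *ₚ X ^ₚ k) i ≈ 0#
    coeff-CX^-≢ c k i i≢k = trans (coeff-CX^ c k i) (trans (*-congˡ (coeff-X^-≢ k i i≢k)) (zeroʳ c))

  shiftedAssociate-degree : ∀ j u → DegreeBelow (q ℕ.^ (j ℕ.+ length u)) (shiftedAssociate j u)
  shiftedAssociate-degree j []      i _   = refl
  shiftedAssociate-degree j (a ∷ u) = DegreeBelow-+ {u = C (ι a) *ₚ X ^ₚ (q ℕ.^ j)}
    (λ i q^≤i → coeff-CX^-≢ (ι a) (q ℕ.^ j) i
      (ℕ.>⇒≢ (ℕ.<-≤-trans (q^<q^ (ℕ.m<m+n j (s≤s z≤n))) q^≤i)))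
    (≡.subst (λ k → DegreeBelow (q ℕ.^ k) (shiftedAssociate (suc j) u)) (≡.sym (ℕ.+-suc j (length u)))
      (shiftedAssociate-degree (suc j) u))

  shiftedAssociate-low : ∀ j u i → i ℕ.< q ℕ.^ j → coeff (shiftedAssociate j u) i ≈ 0#
  shiftedAssociate-low j []      i i<q^j = refl
  shiftedAssociate-low j (a ∷ u) i i<q^j = begin
    coeff (C (ι a) *ₚ X ^ₚ (q ℕ.^ j) +ₚ shiftedAssociate (suc j) u) i
      ≈⟨ coeff-+ (C (ι a) *ₚ X ^ₚ (q ℕ.^ j)) (shiftedAssociate (suc j) u) i ⟩
    coeff (C (ι a) *ₚ X ^ₚ (q ℕ.^ j)) i + coeff (shiftedAssociate (suc j) u) i
      ≈⟨ +-cong (coeff-CX^-≢ (ι a) (q ℕ.^ j) i (ℕ.<⇒≢ i<q^j))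
                (shiftedAssociate-low (suc j) u i (ℕ.<-trans i<q^j (q^<q^ (ℕ.n<1+n j)))) ⟩
    0# + 0#   ≈⟨ +-identityˡ 0# ⟩
    0#        ∎

  -- At exponent `q ℕ.^ j` only the first coefficient of `u` is visible, since the rest starts at
  -- `q ℕ.^ suc j`. Once it is zero, the rest vanishes as well.
  shiftedAssociate≈0 : ∀ j u → shiftedAssociate j u ≈ₚ 0ₚ → u F[x].≈ₚ F[x].0ₚ
  shiftedAssociate≈0 j []      _    = F.Pₚ.refl
  shiftedAssociate≈0 j (a ∷ u) eq = F.Pₚ.trans
    (F.∷-cong a≈0 (shiftedAssociate≈0 (suc j) u rest≈0)) F.shift-[]
    where
    head = C (ι a) *ₚ X ^ₚ (q ℕ.^ j)
    rest = shiftedAssociate (suc j) u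

    ιa≈0 : ι a ≈ 0#
    ιa≈0 = begin
      ι a                                           ≈⟨ *-identityʳ (ι a) ⟨
      ι a * 1#                                      ≈⟨ *-congˡ (coeff-X^-≡ (q ℕ.^ j)) ⟨
      ι a * coeff (X ^ₚ (q ℕ.^ j)) (q ℕ.^ j)        ≈⟨ coeff-CX^ (ι a) (q ℕ.^ j) (q ℕ.^ j) ⟨
      coeff head (q ℕ.^ j)                          ≈⟨ +-identityʳ _ ⟨
      coeff head (q ℕ.^ j) + 0#                     ≈⟨ +-congˡ (shiftedAssociate-low (suc j) u _ (q^<q^ (ℕ.n<1+n j))) ⟨
      coeff head (q ℕ.^ j) + coeff rest (q ℕ.^ j)   ≈⟨ coeff-+ head rest _ ⟨
      coeff (head +ₚ rest) (q ℕ.^ j)                ≈⟨ coeff-≈ eq _ ⟩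
      0#                                            ∎

    a≈0 : a F.≈ F.0#
    a≈0 = ι≈0 ιa≈0

    rest≈0 : rest ≈ₚ 0ₚ
    rest≈0 = coeffwise λ i → begin
      coeff rest i                 ≈⟨ +-identityˡ _ ⟨
      0# + coeff rest i            ≈⟨ +-congʳ (trans (coeff-CX^ (ι a) (q ℕ.^ j) i) (trans (*-congʳ ιa≈0) (zeroˡ _))) ⟨
      coeff head i + coeff rest i  ≈⟨ coeff-+ head rest i ⟨
      coeff (head +ₚ rest) i       ≈⟨ coeff-≈ eq i ⟩
      0#                           ∎

  -- The associate of a list of length at most n has degree below qⁿ, and every one of the qⁿ
  -- elements of K is a root. The bound on the associate counts list entries, hence the trimming.
  annihilator≈0 : ∀ u → F[x].DegreeBelow n u → (∀ y → ℒ u y ≈ 0#) → u F[x].≈ₚ F[x].0ₚ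
  annihilator≈0 u deg ℒu≈0 with F.trim n u deg
  ... | v , v≈u , |v|≤n = F.Pₚ.trans (F.Pₚ.sym v≈u) (shiftedAssociate≈0 0 v
    (roots⇒≈0 (q ℕ.^ n) (shiftedAssociate 0 v) element element-injective
      (λ i → trans (eval-shiftedAssociate 0 v (element i))
                   (trans (ℒ-congʳ v (*-identityʳ _)) (trans (ℒ-cong v u v≈u _) (ℒu≈0 _))))
      (DegreeBelow-mono {u = shiftedAssociate 0 v}
        (ℕ.^-monoʳ-≤ q {{ℕ.>-nonZero (ℕ.<-trans (s≤s z≤n) 1<q)}} |v|≤n) (shiftedAssociate-degree 0 v))))

  -- The image of `ι` already gives q roots of x^q - x. A fixed element outside it would be one root
  -- too many.
  fixed⇒base : ∀ {y} → Fixed y → ∃ λ a → y ≈ ι a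
  fixed⇒base {y} φy≈y with F.any? {P = λ a → y ≈ ι a} (λ a≈b y≈ιa → trans y≈ιa (ι-cong a≈b)) (λ a → y ≟ ι a)
  ... | yes found = found
  ... | no  ∄     = contradiction
      (roots⇒≈0 (suc q) (X ^ₚ q -ₚ X) r r-injective r-root (Monic.degreeBelow monic))
      (monic≉0 1≉0 monic)
    where
    monic : Monic q (X ^ₚ q -ₚ X)
    monic = monic-X^-u (DegreeBelow-mono {u = X} 1<q (DegreeBelow-length X))

    r : Fin (suc q) → Carrier
    r zero    = y
    r (suc i) = ι (F.element i)

    r-fixed : ∀ i → Fixed (r i)
    r-fixed zero    = φy≈y
    r-fixed (suc i) = ι-fixed _

    r-injective : Injective _≡_ _≈_ r
    r-injective {zero}  {zero}  eq = ≡.refl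
    r-injective {zero}  {suc j} eq = contradiction (F.element j , eq) ∄
    r-injective {suc i} {zero}  eq = contradiction (F.element i , sym eq) ∄
    r-injective {suc i} {suc j} eq = ≡.cong suc (F.element-injective (ι-injective eq))

    r-root : ∀ i → eval (X ^ₚ q -ₚ X) (r i) ≈ 0#
    r-root i = begin
      eval (X ^ₚ q -ₚ X) (r i)              ≈⟨ eval-minus (X ^ₚ q) X (r i) ⟩
      eval (X ^ₚ q) (r i) - eval X (r i)    ≈⟨ +-cong (trans (eval-X^ q (r i)) (r-fixed i)) (-‿cong (eval-X (r i))) ⟩
      r i - r i                             ≈⟨ -‿inverseʳ (r i) ⟩
      0#                                    ∎

  tr∈F : ∀ y → ∃ λ a → tr y ≈ ι a
  tr∈F y = fixed⇒base (tr-fixed y)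

  -- If the trace vanished everywhere, `E` would be a nonzero annihilator of degree below n. One
  -- nonzero value `b` is enough: scaling by `a F.* b F.⁻¹` turns it into `a`.
  tr-surjective : ∀ a → ∃ λ y → tr y ≈ ι a
  tr-surjective a with any? {P = λ y → tr y ≉ 0#}
    (λ x≈y tr≉0 eq → tr≉0 (trans (ℒ-congʳ E x≈y) eq)) (λ y → ¬? (tr y ≟ 0#))
  ... | no ∄ = contradiction
      (annihilator≈0 E degree-E λ y → decidable-stable (tr y ≟ 0#) λ tr≉0 → ∄ (y , tr≉0))
      (F.monic≉0 F.1≉0 monic-E)
    where
    degree-E : F[x].DegreeBelow n E
    degree-E = ≡.subst (λ k → F[x].DegreeBelow k E) (ℕ.m+[n∸m]≡n 1≤n) (F.Monic.degreeBelow monic-E)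
  ... | yes (y , tr≉0) with tr∈F y
  ...   | b , tr≈ιb = ι (a F.* b F.⁻¹) * y , (begin
    tr (ι (a F.* b F.⁻¹) * y)       ≈⟨ ℒ-homogeneous E y (ι-fixed _) ⟩
    ι (a F.* b F.⁻¹) * tr y         ≈⟨ *-congˡ tr≈ιb ⟩
    ι (a F.* b F.⁻¹) * ι b          ≈⟨ ι-* _ b ⟨
    ι (a F.* b F.⁻¹ F.* b)          ≈⟨ ι-cong (F.*-assoc a (b F.⁻¹) b) ⟩
    ι (a F.* (b F.⁻¹ F.* b))        ≈⟨ ι-cong (F.*-congˡ (F.trans (F.*-comm _ b) (F.*-inverseʳ b b≉0))) ⟩
    ι (a F.* F.1#)                  ≈⟨ ι-cong (F.*-identityʳ a) ⟩
    ι a                             ∎)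
    where
    b≉0 : b F.≉ F.0#
    b≉0 b≈0 = tr≉0 (trans tr≈ιb (trans (ι-cong b≈0) ι-0))

  -- At a fixed `t` the powers of `t` are scalars, so the trace of the coefficients becomes the
  -- trace of the value.
  eval-T : ∀ f {t} → Fixed t → eval (T f) t ≈ tr (eval f t)
  eval-T []      {t} φt≈t = sym (ℒ-0 E)
  eval-T (c ∷ f) {t} φt≈t = begin
    eval Tr c + t * eval (T f) t      ≈⟨ +-cong (eval-Tr c) (*-congˡ (eval-T f φt≈t)) ⟩
    tr c + t * tr (eval f t)          ≈⟨ +-congˡ (ℒ-homogeneous E (eval f t) φt≈t) ⟨
    tr c + tr (t * eval f t)          ≈⟨ ℒ-additive E c _ ⟨
    tr (c + t * eval f t)             ∎

-- The permutation criterion.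

module PermutationCriterion
  {c₁ ℓ₁ c₂ ℓ₂} {p q n e : ℕ} (p-prime : Prime p) (1≤e : 1 ≤ e) (q≡p^e : q ≡ p ℕ.^ e) (1≤n : 1 ≤ n)
  (F′ : FiniteField c₁ ℓ₁ q) (K′ : FiniteField c₂ ℓ₂ (q ℕ.^ n))
  (ι : FiniteField.Carrier F′ → FiniteField.Carrier K′)
  (ι-inclusion : Extension.IsInclusion q n F′ K′ ι)
  (h : Polynomial.Poly (FiniteField.commutativeRing F′))
  (f k : Polynomial.Poly (FiniteField.commutativeRing K′))
  (k-units : Extension.MapsBaseToUnits q n F′ K′ ι k)
  where

  open FrobeniusOperators p-prime 1≤e q≡p^e 1≤n F′ K′ ι ι-inclusion public
  open ≈-Reasoning

  h[1] : F.Carrier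
  h[1] = F[x].eval h F.1#

  P Q : Poly
  P = f ∘ₚ Tr +ₚ (k ∘ₚ Tr) *ₚ L h
  Q = T f +ₚ k *ₚ C (ι h[1]) *ₚ X

  eval-∘Tr : ∀ u x → eval (u ∘ₚ Tr) x ≈ eval u (tr x)
  eval-∘Tr u x = trans (eval-∘ u Tr x) (eval-congʳ u (eval-Tr x))

  eval-P : ∀ x → eval P x ≈ eval f (tr x) + eval k (tr x) * ℒ h x
  eval-P x = trans (eval-+ (f ∘ₚ Tr) ((k ∘ₚ Tr) *ₚ L h) x)
    (+-cong (eval-∘Tr f x) (trans (eval-* (k ∘ₚ Tr) (L h) x) (*-cong (eval-∘Tr k x) (eval-L h x))))

  eval-Q : ∀ {t} → Fixed t → eval Q t ≈ tr (eval f t) + eval k t * ι h[1] * t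
  eval-Q {t} φt≈t = trans (eval-+ (T f) (k *ₚ C (ι h[1]) *ₚ X) t)
    (+-cong (eval-T f φt≈t) (trans (eval-* (k *ₚ C (ι h[1])) X t)
      (*-cong (trans (eval-* k (C (ι h[1])) t) (*-congˡ (eval-C _ t))) (eval-X t))))

  k-unit : ∀ {t a} → t ≈ ι a → ∃ λ b → b F.≉ F.0# × eval k t ≈ ι b
  k-unit {a = a} t≈ιa with k-units a
  ... | b , b≉0 , k[ιa]≈ιb = b , b≉0 , trans (eval-congʳ k t≈ιa) k[ιa]≈ιb

  k[tr]-fixed : ∀ x → Fixed (eval k (tr x))
  k[tr]-fixed x with k-unit (proj₂ (tr∈F x))
  ... | b , _ , k≈ιb = trans (φ-cong k≈ιb) (trans (ι-fixed b) (sym k≈ιb))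

  k[tr]≉0 : ∀ x → eval k (tr x) ≉ 0#
  k[tr]≉0 x with k-unit (proj₂ (tr∈F x))
  ... | b , b≉0 , k≈ιb = ι≉0 b≉0 ∘ trans (sym k≈ιb)

  -- k(tr x) is a scalar for the trace, and the trace commutes with `ℒ h`, which acts on the fixed
  -- element `tr x` as multiplication by h(1).
  tr-P : ∀ x → tr (eval P x) ≈ eval Q (tr x)
  tr-P x = begin
    tr (eval P x)                              ≈⟨ ℒ-congʳ E (eval-P x) ⟩
    tr (eval f t + eval k t * ℒ h x)           ≈⟨ ℒ-additive E _ _ ⟩
    tr (eval f t) + tr (eval k t * ℒ h x)      ≈⟨ +-congˡ (ℒ-homogeneous E (ℒ h x) (k[tr]-fixed x)) ⟩
    tr (eval f t) + eval k t * tr (ℒ h x)      ≈⟨ +-congˡ (*-congˡ (trans (ℒ-comm E h x) (ℒ-fixed h (tr-fixed x)))) ⟩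
    tr (eval f t) + eval k t * (ι h[1] * t)    ≈⟨ +-congˡ (*-assoc _ _ _) ⟨
    tr (eval f t) + eval k t * ι h[1] * t      ≈⟨ eval-Q (tr-fixed x) ⟨
    eval Q t                                   ∎
    where t = tr x

  module _ (P-bijective : IsPermutationPolynomial P) where

    -- On the kernel of the trace `P` is f(0) + k(0) `ℒ h`, so an element also killed by `ℒ h` has
    -- the same image as 0.
    kernels-disjoint : ∀ y → tr y ≈ 0# → ℒ h y ≈ 0# → y ≈ 0#
    kernels-disjoint y tr≈0 ℒh≈0 = proj₁ P-bijective (begin
      eval P y                                      ≈⟨ eval-P y ⟩
      eval f (tr y) + eval k (tr y) * ℒ h y
        ≈⟨ +-cong (eval-congʳ f tr≈tr0) (*-cong (eval-congʳ k tr≈tr0) (trans ℒh≈0 (sym (ℒ-0 h)))) ⟩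
      eval f (tr 0#) + eval k (tr 0#) * ℒ h 0#      ≈⟨ eval-P 0# ⟨
      eval P 0#                                     ∎)
      where tr≈tr0 = trans tr≈0 (sym (ℒ-0 E))

    -- Let z divide h and E, and v z = xⁿ - 1.  Then ℒ z is injective, hence onto, so ℒ v vanishes
    -- on K and xⁿ - 1 divides v; hence z is a unit.
    permutation⇒coprime : F[x].Coprimeₚ h E
    permutation⇒coprime {z} (x , xz≈h) (w , wz≈E) = s , F.Pₚ.x-y≈0⇒x≈y (s F[x].*ₚ z) F[x].1ₚ
      (F.monic-cancel monic-xⁿ-1 sz-1 (λ i _ → F[x].coeff-≈ [sz-1]m≈0 i))
      where
      ℒz-injective : Injective _≈_ _≈_ (ℒ z)
      ℒz-injective {a} {b} eq = x-y≈0⇒x≈y a b (kernels-disjoint (a - b) (through w E wz≈E) (through x h xz≈h))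
        where
        ℒz≈0 : ℒ z (a - b) ≈ 0#
        ℒz≈0 = trans (ℒ-minus z a b) (x≈y⇒x-y≈0 eq)

        through : ∀ u v → u F[x].*ₚ z F[x].≈ₚ v → ℒ v (a - b) ≈ 0#
        through u v uz≈v = begin
          ℒ v (a - b)                ≈⟨ ℒ-cong (u F[x].*ₚ z) v uz≈v (a - b) ⟨
          ℒ (u F[x].*ₚ z) (a - b)    ≈⟨ ℒ-* u z (a - b) ⟩
          ℒ u (ℒ z (a - b))          ≈⟨ ℒ-congʳ u ℒz≈0 ⟩
          ℒ u 0#                     ≈⟨ ℒ-0 u ⟩
          0#                         ∎

      X-1 = F[x].X F[x].-ₚ F[x].1ₚ
      v = X-1 F[x].*ₚ w

      vz≈xⁿ-1 : v F[x].*ₚ z F[x].≈ₚ xⁿ-1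
      vz≈xⁿ-1 = F.Pₚ.trans (F.Pₚ.*-assoc X-1 w z)
        (F.Pₚ.trans (F.*ₚ-congˡ X-1 wz≈E) (F[x].[X-1]*[Xⁿ-1]/[X-1] n))

      ℒv≈0 : ∀ y → ℒ v y ≈ 0#
      ℒv≈0 y with injective⇒surjective (ℒ-congʳ z) ℒz-injective y
      ... | y′ , ℒz[y′]≈y = begin
        ℒ v y                    ≈⟨ ℒ-congʳ v (ℒz[y′]≈y refl) ⟨
        ℒ v (ℒ z y′)             ≈⟨ ℒ-* v z y′ ⟨
        ℒ (v F[x].*ₚ z) y′       ≈⟨ ℒ-cong _ _ vz≈xⁿ-1 y′ ⟩
        ℒ xⁿ-1 y′                ≈⟨ ℒ-xⁿ-1 y′ ⟩
        0#                       ∎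

      -- `annihilator≈0` needs degree below n, so it is applied to the remainder of `v`, which acts
      -- like `v` because xⁿ - 1 acts as zero.
      division = F.divide monic-xⁿ-1 v
      s = proj₁ division
      r = proj₁ (proj₂ division)
      v≈sm+r = proj₁ (proj₂ (proj₂ division))

      ℒr≈0 : ∀ y → ℒ r y ≈ 0#
      ℒr≈0 y = begin
        ℒ r y                                    ≈⟨ +-identityˡ _ ⟨
        0# + ℒ r y                               ≈⟨ +-congʳ (trans (ℒ-* s xⁿ-1 y) (trans (ℒ-congʳ s (ℒ-xⁿ-1 y)) (ℒ-0 s))) ⟨
        ℒ (s F[x].*ₚ xⁿ-1) y + ℒ r y             ≈⟨ ℒ-+ (s F[x].*ₚ xⁿ-1) r y ⟨
        ℒ (s F[x].*ₚ xⁿ-1 F[x].+ₚ r) y           ≈⟨ ℒ-cong _ _ v≈sm+r y ⟨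
        ℒ v y                                    ≈⟨ ℒv≈0 y ⟩
        0#                                       ∎

      v≈sm : v F[x].≈ₚ s F[x].*ₚ xⁿ-1
      v≈sm = F.Pₚ.trans v≈sm+r (F.Pₚ.trans
        (F.+ₚ-congˡ (s F[x].*ₚ xⁿ-1) (annihilator≈0 r (proj₂ (proj₂ (proj₂ division))) ℒr≈0))
        (F.Pₚ.+-identityʳ _))

      sz-1 = s F[x].*ₚ z F[x].-ₚ F[x].1ₚ

      [sz-1]m≈0 : sz-1 F[x].*ₚ xⁿ-1 F[x].≈ₚ F[x].0ₚ
      [sz-1]m≈0 = F.Pₚ.vanish-factor {v} {z} {xⁿ-1} {s} vz≈xⁿ-1 v≈sm

    -- Surjectivity descends along the trace: lift `b` to K, take its preimage under `P`, and take
    -- the trace of that. Injectivity does not descend this way and comes from finiteness.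
    permutation⇒permutesBase : PermutesBase Q
    permutation⇒permutesBase = σ , induces , F.surjective⇒injective σ-cong σ-surjective , σ-surjective
      where
      σ : F.Carrier → F.Carrier
      σ a = proj₁ (tr∈F (eval P (proj₁ (tr-surjective a))))

      induces : InducesOnBase Q σ
      induces a = begin
        eval Q (ι a)        ≈⟨ eval-congʳ Q (proj₂ (tr-surjective a)) ⟨
        eval Q (tr y)       ≈⟨ tr-P y ⟨
        tr (eval P y)       ≈⟨ proj₂ (tr∈F (eval P y)) ⟩
        ι (σ a)             ∎
        where y = proj₁ (tr-surjective a)

      σ-cong : Congruent F._≈_ F._≈_ σ
      σ-cong {a} {b} a≈b = ι-injective
        (trans (sym (induces a)) (trans (eval-congʳ Q (ι-cong a≈b)) (induces b)))

      σ-surjective : Surjective F._≈_ F._≈_ σ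
      σ-surjective b = a , λ {z} z≈a → ι-injective (begin
        ι (σ z)          ≈⟨ induces z ⟨
        eval Q (ι z)     ≈⟨ eval-congʳ Q (trans (ι-cong z≈a) (sym (proj₂ (tr∈F x)))) ⟩
        eval Q (tr x)    ≈⟨ tr-P x ⟨
        tr (eval P x)    ≈⟨ ℒ-congʳ E (proj₂ (proj₂ P-bijective y) refl) ⟩
        tr y             ≈⟨ proj₂ (tr-surjective b) ⟩
        ι b              ∎)
        where
        y = proj₁ (tr-surjective b)
        x = proj₁ (proj₂ P-bijective y)
        a = proj₁ (tr∈F x)

  -- A Bézout identity for `h` and `E`, applied to `y`, writes `y` as a sum of two zeros.
  coprime⇒kernels-disjoint : F[x].Coprimeₚ h E → ∀ y → tr y ≈ 0# → ℒ h y ≈ 0# → y ≈ 0#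
  coprime⇒kernels-disjoint coprime y tr≈0 ℒh≈0 with F.coprime⇒bézout h E coprime
  ... | a , b , ah+bE≈1 = begin
    y                                                ≈⟨ ℒ-1 y ⟨
    ℒ F[x].1ₚ y                                      ≈⟨ ℒ-cong _ _ ah+bE≈1 y ⟨
    ℒ (a F[x].*ₚ h F[x].+ₚ b F[x].*ₚ E) y            ≈⟨ ℒ-+ (a F[x].*ₚ h) (b F[x].*ₚ E) y ⟩
    ℒ (a F[x].*ₚ h) y + ℒ (b F[x].*ₚ E) y            ≈⟨ +-cong (vanishes a h ℒh≈0) (vanishes b E tr≈0) ⟩
    0# + 0#                                          ≈⟨ +-identityˡ 0# ⟩
    0#                                               ∎
    where
    vanishes : ∀ u v → ℒ v y ≈ 0# → ℒ (u F[x].*ₚ v) y ≈ 0#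
    vanishes u v ℒv≈0 = trans (ℒ-* u v y) (trans (ℒ-congʳ u ℒv≈0) (ℒ-0 u))

  -- Equal values of `P` have equal traces, so injectivity of `σ` puts the arguments in one fibre of
  -- the trace. There the f-terms agree and the unit k(tr x) cancels, so the difference lies in both
  -- kernels.
  coprime∧permutesBase⇒permutation : F[x].Coprimeₚ h E → PermutesBase Q → IsPermutationPolynomial P
  coprime∧permutesBase⇒permutation coprime (σ , induces , σ-injective , _) =
    P-injective , injective⇒surjective (eval-congʳ P) P-injective
    where
    tr-determined : ∀ {x y} → eval P x ≈ eval P y → tr x ≈ tr y
    tr-determined {x} {y} eq = begin
      tr x   ≈⟨ proj₂ (tr∈F x) ⟩
      ι a    ≈⟨ ι-cong (σ-injective (ι-injective (begin
        ι (σ a)           ≈⟨ induces a ⟨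
        eval Q (ι a)      ≈⟨ eval-congʳ Q (proj₂ (tr∈F x)) ⟨
        eval Q (tr x)     ≈⟨ tr-P x ⟨
        tr (eval P x)     ≈⟨ ℒ-congʳ E eq ⟩
        tr (eval P y)     ≈⟨ tr-P y ⟩
        eval Q (tr y)     ≈⟨ eval-congʳ Q (proj₂ (tr∈F y)) ⟩
        eval Q (ι b)      ≈⟨ induces b ⟩
        ι (σ b)           ∎))) ⟩
      ι b    ≈⟨ proj₂ (tr∈F y) ⟨
      tr y   ∎
      where
      a = proj₁ (tr∈F x)
      b = proj₁ (tr∈F y)

    P-injective : Injective _≈_ _≈_ (eval P)
    P-injective {x} {y} eq = x-y≈0⇒x≈y x y (coprime⇒kernels-disjoint coprime (x - y)
      (trans (ℒ-minus E x y) (x≈y⇒x-y≈0 trx≈try)) (trans (ℒ-minus h x y) (x≈y⇒x-y≈0 ℒhx≈ℒhy)))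
      where
      trx≈try = tr-determined eq

      ℒhx≈ℒhy : ℒ h x ≈ ℒ h y
      ℒhx≈ℒhy = *-cancelʳ-≉0 (k[tr]≉0 x) (trans (*-comm _ _) (trans
        (+-cancelˡ (eval f (tr x)) _ _ (begin
          eval f (tr x) + eval k (tr x) * ℒ h x    ≈⟨ eval-P x ⟨
          eval P x                                 ≈⟨ eq ⟩
          eval P y                                 ≈⟨ eval-P y ⟩
          eval f (tr y) + eval k (tr y) * ℒ h y    ≈⟨ +-cong (eval-congʳ f trx≈try) (*-congʳ (eval-congʳ k trx≈try)) ⟨
          eval f (tr x) + eval k (tr x) * ℒ h y    ∎))
        (*-comm _ _)))

  -- When p ∣ n, E(1) = 0 and x - 1 divides E. Whatever is coprime to E is then coprime to x - 1 as
  -- well, hence to the product (x - 1)E. The converse only needs E to divide xⁿ - 1.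
  coprime-E⇔coprime-xⁿ-1 : p ∣ n → F[x].Coprimeₚ h E ⇔ F[x].Coprimeₚ h xⁿ-1
  coprime-E⇔coprime-xⁿ-1 p∣n = mk⇔ to from
    where
    X-1 = F[x].X F[x].-ₚ F[x].1ₚ

    to : F[x].Coprimeₚ h E → F[x].Coprimeₚ h xⁿ-1
    to coprime with F.coprime⇒bézout h E coprime
                  | F.factor-root E F.1# (F.trans (F.eval-[Xⁿ-1]/[X-1] n) (CharF.p∣a⇒a·1≈0 p∣n))
    ... | a , b , ah+bE≈1 | s , E≈s[X-1] = F.bézout⇒coprime h xⁿ-1 u (b F[x].*ₚ s F[x].*ₚ b)
      (F.Pₚ.trans (F.+ₚ-congˡ (u F[x].*ₚ h) (F.*ₚ-congˡ (b F[x].*ₚ s F[x].*ₚ b) (F.Pₚ.sym (F[x].[X-1]*[Xⁿ-1]/[X-1] n))))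
        (F.Pₚ.bézout-* {a} {h} {b F[x].*ₚ s} {X-1} {a} {b} {E} ah+bs[X-1]≈1 ah+bE≈1))
      where
      u = a F[x].*ₚ (a F[x].*ₚ h F[x].+ₚ b F[x].*ₚ E) F[x].+ₚ b F[x].*ₚ s F[x].*ₚ X-1 F[x].*ₚ a

      ah+bs[X-1]≈1 : a F[x].*ₚ h F[x].+ₚ b F[x].*ₚ s F[x].*ₚ X-1 F[x].≈ₚ F[x].1ₚ
      ah+bs[X-1]≈1 = F.Pₚ.trans (F.+ₚ-congˡ (a F[x].*ₚ h)
        (F.Pₚ.trans (F.Pₚ.*-assoc b s X-1) (F.*ₚ-congˡ b (F.Pₚ.sym E≈s[X-1])))) ah+bE≈1

    from : F[x].Coprimeₚ h xⁿ-1 → F[x].Coprimeₚ h E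
    from coprime {z} z∣h (w , wz≈E) = coprime z∣h (X-1 F[x].*ₚ w ,
      F.Pₚ.trans (F.Pₚ.*-assoc X-1 w z) (F.Pₚ.trans (F.*ₚ-congˡ X-1 wz≈E) (F[x].[X-1]*[Xⁿ-1]/[X-1] n)))

  -- The inverse permutation.

  P₀ : (G : Poly) (R H : F[x].Poly) → Poly
  P₀ G R H = G ∘ₚ Tr +ₚ (k ∘ₚ embed R ∘ₚ Tr) ^ₚ (q ∸ 2) *ₚ L H

  -- Evaluating hH = wE + 1 at 1 gives h(1)H(1) = n w(1) + 1, so the coefficient of x is -w(1). It
  -- removes the multiple of the trace by which `ℒ H` fails to invert `ℒ h`.
  M : F[x].Poly → Poly
  M H = (-ₚ (k ^ₚ (q ∸ 2) *ₚ (L H ∘ₚ f)))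
    +ₚ X *ₚ C (ι ((F.1# F.- h[1] F.* F[x].eval H F.1#) F.* (n F.· F.1#) F.⁻¹))

  -- x^q - x vanishes at fixed elements, and `G` is evaluated only at traces; this is why F matters
  -- only modulo x^q - x.
  eval-≅ : ∀ {G N} → G ≅ N [modₚ X ^ₚ q -ₚ X ] → ∀ {t} → Fixed t → eval G t ≈ eval N t
  eval-≅ {G} {N} (w , w[X^q-X]≈G-N) {t} φt≈t = x-y≈0⇒x≈y _ _ (begin
    eval G t - eval N t                 ≈⟨ eval-minus G N t ⟨
    eval (G -ₚ N) t                     ≈⟨ eval-cong w[X^q-X]≈G-N t ⟨
    eval (w *ₚ (X ^ₚ q -ₚ X)) t         ≈⟨ eval-* w (X ^ₚ q -ₚ X) t ⟩
    eval w t * eval (X ^ₚ q -ₚ X) t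
      ≈⟨ *-congˡ (trans (eval-minus (X ^ₚ q) X t) (+-cong (eval-X^ q t) (-‿cong (eval-X t)))) ⟩
    eval w t * (φ t - t)                ≈⟨ *-congˡ (x≈y⇒x-y≈0 φt≈t) ⟩
    eval w t * 0#                       ≈⟨ zeroʳ _ ⟩
    0#                                  ∎)

  ℒ-inverse : ∀ H m w → h F[x].*ₚ H F[x].≈ₚ w F[x].*ₚ m F[x].+ₚ F[x].1ₚ →
              ∀ x → ℒ H (ℒ h x) ≈ ℒ w (ℒ m x) + x
  ℒ-inverse H m w hH≈wm+1 x = begin
    ℒ H (ℒ h x)                          ≈⟨ ℒ-comm H h x ⟩
    ℒ h (ℒ H x)                          ≈⟨ ℒ-* h H x ⟨
    ℒ (h F[x].*ₚ H) x                    ≈⟨ ℒ-cong _ _ hH≈wm+1 x ⟩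
    ℒ (w F[x].*ₚ m F[x].+ₚ F[x].1ₚ) x    ≈⟨ ℒ-+ (w F[x].*ₚ m) F[x].1ₚ x ⟩
    ℒ (w F[x].*ₚ m) x + ℒ F[x].1ₚ x      ≈⟨ +-cong (ℒ-* w m x) (ℒ-1 x) ⟩
    ℒ w (ℒ m x) + x                      ∎

  -- From y^q = y by cancelling. As q ≥ 2, the truncated subtraction is exact; for q = 2 the
  -- exponent is 0, which is right because then y = 1.
  fixed⇒inverse : ∀ {y} → y ≉ 0# → Fixed y → y ^ (q ∸ 2) * y ≈ 1#
  fixed⇒inverse {y} y≉0 φy≈y = *-cancelʳ-≉0 y≉0 (begin
    y ^ (q ∸ 2) * y * y          ≈⟨ solve 2 (λ z y → z :* y :* y := y :* (y :* z)) refl (y ^ (q ∸ 2)) y ⟩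
    y ^ (2 ℕ.+ (q ∸ 2))          ≈⟨ ^-congʳ y (ℕ.m+[n∸m]≡n 1<q) ⟩
    φ y                          ≈⟨ φy≈y ⟩
    y                            ≈⟨ *-identityˡ y ⟨
    1# * y                       ∎)

  -- `P` is onto, so checking one composite is enough.
  leftInverse⇒inducesInverse : IsPermutationPolynomial P → ∀ u →
    (∀ x → eval u (eval P x) ≈ x) → InducesInverse u P
  leftInverse⇒inducesInverse (_ , P-surjective) u u∘P = inverseˡ , λ y≈Px → trans (eval-congʳ u y≈Px) (u∘P _)
    where
    inverseˡ : ∀ {x y} → y ≈ eval u x → eval P y ≈ x
    inverseˡ {x} {y} y≈ux = begin
      eval P y                       ≈⟨ eval-congʳ P y≈ux ⟩
      eval P (eval u x)              ≈⟨ eval-congʳ P (eval-congʳ u (proj₂ (P-surjective x) refl)) ⟨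
      eval P (eval u (eval P z))     ≈⟨ eval-congʳ P (u∘P z) ⟩
      eval P z                       ≈⟨ proj₂ (P-surjective x) refl ⟩
      x                              ∎
      where z = proj₁ (P-surjective x)

  module _ (R : F[x].Poly) (R-inverse : InducesInverseOnBase R Q) (H : F[x].Poly) where

    private
      σ = proj₁ R-inverse

      R∘Q : ∀ {a} → eval (embed R) (eval Q (ι a)) ≈ ι a
      R∘Q {a} = begin
        eval (embed R) (eval Q (ι a))    ≈⟨ eval-congʳ (embed R) (proj₁ (proj₂ R-inverse) a) ⟩
        eval (embed R) (ι (σ a))         ≈⟨ eval-embed R (σ a) ⟩
        ι (F[x].eval R (σ a))            ≈⟨ ι-cong (proj₂ (proj₂ (proj₂ R-inverse)) F.refl) ⟩
        ι a                              ∎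

    R∘Q∘tr : ∀ x → eval (embed R) (eval Q (tr x)) ≈ tr x
    R∘Q∘tr x = trans (eval-congʳ (embed R) (eval-congʳ Q tr≈ι)) (trans R∘Q (sym tr≈ι))
      where tr≈ι = proj₂ (tr∈F x)

    -- The contribution of f(t) to k(t)^(q-2) L_H(P(x)), which F has to cancel.
    correction : Carrier → Carrier
    correction t = eval k t ^ (q ∸ 2) * ℒ H (eval f t)

    -- Common to both cases, which differ only in `d`. From y = P(x) the trace of y is Q(tr x), so
    -- `R` recovers `tr x` and with it the scalar k(tr x), whose power q - 2 undoes the
    -- multiplication in `P`.
    P₀∘P : ∀ G {x d} → eval G (eval Q (tr x)) ≈ - correction (tr x) + d →
           eval (P₀ G R H) (eval P x) ≈ d + ℒ H (ℒ h x)
    P₀∘P G {x} {d} G≈ = begin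
      eval (P₀ G R H) y
        ≈⟨ eval-+ (G ∘ₚ Tr) (kR ^ₚ (q ∸ 2) *ₚ L H) y ⟩
      eval (G ∘ₚ Tr) y + eval (kR ^ₚ (q ∸ 2) *ₚ L H) y
        ≈⟨ +-cong (trans (eval-∘Tr G y) (trans (eval-congʳ G (tr-P x)) G≈))
                  (trans (eval-* (kR ^ₚ (q ∸ 2)) (L H) y) (*-cong κ-eval (eval-L H y))) ⟩
      - correction t + d + κ′ * ℒ H y
        ≈⟨ +-congˡ (*-congˡ (trans (ℒ-congʳ H (eval-P x)) (trans (ℒ-additive H _ _)
             (+-congˡ (ℒ-homogeneous H (ℒ h x) (k[tr]-fixed x)))))) ⟩
      - correction t + d + κ′ * (ℒ H (eval f t) + κ * ℒ H (ℒ h x))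
        ≈⟨ solve 6 (λ c d κ′ l κ m → c :+ d :+ κ′ :* (l :+ κ :* m) := (c :+ κ′ :* l) :+ (d :+ (κ′ :* κ) :* m))
             refl (- correction t) d κ′ (ℒ H (eval f t)) κ (ℒ H (ℒ h x)) ⟩
      - correction t + correction t + (d + κ′ * κ * ℒ H (ℒ h x))
        ≈⟨ +-cong (-‿inverseˡ _) (+-congˡ (*-congʳ (fixed⇒inverse (k[tr]≉0 x) (k[tr]-fixed x)))) ⟩
      0# + (d + 1# * ℒ H (ℒ h x))
        ≈⟨ trans (+-identityˡ _) (+-congˡ (*-identityˡ _)) ⟩
      d + ℒ H (ℒ h x) ∎
      where
      t = tr x
      y = eval P x
      κ = eval k t
      κ′ = κ ^ (q ∸ 2)
      kR = k ∘ₚ embed R ∘ₚ Tr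

      κ-eval : eval (kR ^ₚ (q ∸ 2)) y ≈ κ′
      κ-eval = trans (eval-^ kR (q ∸ 2) y) (^-congˡ (q ∸ 2) (begin
        eval kR y                                 ≈⟨ eval-∘ k (embed R ∘ₚ Tr) y ⟩
        eval k (eval (embed R ∘ₚ Tr) y)           ≈⟨ eval-congʳ k (eval-∘Tr (embed R) y) ⟩
        eval k (eval (embed R) (tr y))            ≈⟨ eval-congʳ k (eval-congʳ (embed R) (tr-P x)) ⟩
        eval k (eval (embed R) (eval Q t))        ≈⟨ eval-congʳ k (R∘Q∘tr x) ⟩
        eval k t                                  ∎))

    Q[tr]-fixed : ∀ x → Fixed (eval Q (tr x))
    Q[tr]-fixed x = trans (φ-cong (sym (tr-P x))) (trans (tr-fixed (eval P x)) (tr-P x))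

    -- Here `d` is 0: xⁿ - 1 acts as zero, so `ℒ H` inverts `ℒ h` exactly.
    inverse-p∣n : IsPermutationPolynomial P → F[x].ReducedInverse h xⁿ-1 n H →
      ∀ G → G ≅ -ₚ ((k ∘ₚ embed R) ^ₚ (q ∸ 2) *ₚ (L H ∘ₚ f ∘ₚ embed R)) [modₚ X ^ₚ q -ₚ X ] →
      InducesInverse (P₀ G R H) P
    inverse-p∣n P-bijective (_ , hH≅1) G G≅N = leftInverse⇒inducesInverse P-bijective (P₀ G R H) λ x → begin
      eval (P₀ G R H) (eval P x)      ≈⟨ P₀∘P G (G-value x) ⟩
      0# + ℒ H (ℒ h x)                ≈⟨ +-identityˡ _ ⟩
      ℒ H (ℒ h x)                     ≈⟨ ℒ-inverse H xⁿ-1 w hH≈wm+1 x ⟩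
      ℒ w (ℒ xⁿ-1 x) + x              ≈⟨ +-congʳ (trans (ℒ-congʳ w (ℒ-xⁿ-1 x)) (ℒ-0 w)) ⟩
      0# + x                          ≈⟨ +-identityˡ x ⟩
      x                               ∎
      where
      w = proj₁ (F.≅1⇒≈ (h F[x].*ₚ H) xⁿ-1 hH≅1)
      hH≈wm+1 = proj₂ (F.≅1⇒≈ (h F[x].*ₚ H) xⁿ-1 hH≅1)
      N = (k ∘ₚ embed R) ^ₚ (q ∸ 2) *ₚ (L H ∘ₚ f ∘ₚ embed R)

      G-value : ∀ x → eval G (eval Q (tr x)) ≈ - correction (tr x) + 0#
      G-value x = begin
        eval G s               ≈⟨ eval-≅ {G} { -ₚ N} G≅N (Q[tr]-fixed x) ⟩
        eval (-ₚ N) s          ≈⟨ eval-neg N s ⟩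
        - eval N s             ≈⟨ -‿cong (trans (eval-* ((k ∘ₚ embed R) ^ₚ (q ∸ 2)) (L H ∘ₚ f ∘ₚ embed R) s)
                                    (*-cong
                                      (trans (eval-^ (k ∘ₚ embed R) (q ∸ 2) s)
                                        (^-congˡ (q ∸ 2) (trans (eval-∘ k (embed R) s) (eval-congʳ k (R∘Q∘tr x)))))
                                      (trans (eval-∘ (L H) (f ∘ₚ embed R) s) (trans (eval-L H _)
                                        (ℒ-congʳ H (trans (eval-∘ f (embed R) s) (eval-congʳ f (R∘Q∘tr x)))))))) ⟩
        - correction (tr x)         ≈⟨ +-identityʳ _ ⟨
        - correction (tr x) + 0#    ∎
        where s = eval Q (tr x)

    -- Modulo E alone, the operator of wE leaves w(1) tr x over, and the linear term of `M` supplies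
    -- `d` = -w(1) tr x against it.
    inverse-p∤n : IsPermutationPolynomial P → p ∤ n → F[x].ReducedInverse h E (n ∸ 1) H →
      ∀ G → G ≅ M H ∘ₚ embed R [modₚ X ^ₚ q -ₚ X ] → InducesInverse (P₀ G R H) P
    inverse-p∤n P-bijective p∤n (_ , hH≅1) G G≅N = leftInverse⇒inducesInverse P-bijective (P₀ G R H) λ x → begin
      eval (P₀ G R H) (eval P x)                   ≈⟨ P₀∘P G (G-value x) ⟩
      tr x * ι c + ℒ H (ℒ h x)                     ≈⟨ +-congˡ (ℒ-inverse H E w hH≈wm+1 x) ⟩
      tr x * ι c + (ℒ w (tr x) + x)                ≈⟨ +-congˡ (+-congʳ (ℒ-fixed w (tr-fixed x))) ⟩
      tr x * ι c + (ι w₁ * tr x + x)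
        ≈⟨ solve 4 (λ t c w x → t :* c :+ (w :* t :+ x) := (c :+ w) :* t :+ x) refl (tr x) (ι c) (ι w₁) x ⟩
      (ι c + ι w₁) * tr x + x                      ≈⟨ +-congʳ (*-congʳ (trans (sym (ι-+ c w₁)) (trans (ι-cong c+w₁≈0) ι-0))) ⟩
      0# * tr x + x                                ≈⟨ +-congʳ (zeroˡ _) ⟩
      0# + x                                       ≈⟨ +-identityˡ x ⟩
      x                                            ∎
      where
      w = proj₁ (F.≅1⇒≈ (h F[x].*ₚ H) E hH≅1)
      hH≈wm+1 = proj₂ (F.≅1⇒≈ (h F[x].*ₚ H) E hH≅1)
      w₁ = F[x].eval w F.1#
      H₁ = F[x].eval H F.1#
      n₁ = n F.· F.1#
      c = (F.1# F.- h[1] F.* H₁) F.* n₁ F.⁻¹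

      h₁H₁≈w₁n₁+1 : h[1] F.* H₁ F.≈ w₁ F.* n₁ F.+ F.1#
      h₁H₁≈w₁n₁+1 = F.trans (F.sym (F.eval-* h H F.1#))
        (F.trans (F.eval-cong hH≈wm+1 F.1#)
          (F.trans (F.eval-+ (w F[x].*ₚ E) F[x].1ₚ F.1#)
            (F.+-cong (F.trans (F.eval-* w E F.1#) (F.*-congˡ (F.eval-[Xⁿ-1]/[X-1] n))) (F.eval-C F.1# F.1#))))

      -- Cancelling `n₁` is where p ∤ n enters: n must be nonzero in 𝔽_q for its inverse to mean
      -- anything.
      c+w₁≈0 : c F.+ w₁ F.≈ F.0#
      c+w₁≈0 = F.*-cancelʳ-≉0 n₁≉0 (F≈.begin
        (c F.+ w₁) F.* n₁                                    F≈.≈⟨ F.distribʳ n₁ c w₁ ⟩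
        c F.* n₁ F.+ w₁ F.* n₁                               F≈.≈⟨ F.+-congʳ c*n₁≈ ⟩
        F.1# F.- h[1] F.* H₁ F.+ w₁ F.* n₁                   F≈.≈⟨ F.+-assoc _ _ _ ⟩
        F.1# F.+ (F.- (h[1] F.* H₁) F.+ w₁ F.* n₁)           F≈.≈⟨ F.x+[y+z]≈y+[x+z] _ _ _ ⟩
        F.- (h[1] F.* H₁) F.+ (F.1# F.+ w₁ F.* n₁)           F≈.≈⟨ F.+-congˡ (F.trans (F.+-comm _ _) (F.sym h₁H₁≈w₁n₁+1)) ⟩
        F.- (h[1] F.* H₁) F.+ h[1] F.* H₁                    F≈.≈⟨ F.-‿inverseˡ _ ⟩
        F.0#                                                 F≈.≈⟨ F.zeroˡ n₁ ⟨
        F.0# F.* n₁                                          F≈.∎)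
        where
        module F≈ = F.≈-Reasoning

        n₁≉0 : n₁ F.≉ F.0#
        n₁≉0 = CharF.p∤a⇒a·1≉0 p∤n

        c*n₁≈ : c F.* n₁ F.≈ F.1# F.- h[1] F.* H₁
        c*n₁≈ = F.trans (F.*-assoc _ _ _)
          (F.trans (F.*-congˡ (F.trans (F.*-comm _ _) (F.*-inverseʳ n₁ n₁≉0))) (F.*-identityʳ _))

      G-value : ∀ x → eval G (eval Q (tr x)) ≈ - correction (tr x) + tr x * ι c
      G-value x = begin
        eval G s                                       ≈⟨ eval-≅ {G} {M H ∘ₚ embed R} G≅N (Q[tr]-fixed x) ⟩
        eval (M H ∘ₚ embed R) s                        ≈⟨ trans (eval-∘ (M H) (embed R) s) (eval-congʳ (M H) (R∘Q∘tr x)) ⟩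
        eval (M H) t                                   ≈⟨ eval-+ (-ₚ N) (X *ₚ C (ι c)) t ⟩
        eval (-ₚ N) t + eval (X *ₚ C (ι c)) t
          ≈⟨ +-cong (trans (eval-neg N t) (-‿cong (trans (eval-* (k ^ₚ (q ∸ 2)) (L H ∘ₚ f) t)
               (*-cong (eval-^ k (q ∸ 2) t) (trans (eval-∘ (L H) f t) (eval-L H _))))))
               (trans (eval-* X (C (ι c)) t) (*-cong (eval-X t) (eval-C _ t))) ⟩
        - correction t + t * ι c                       ∎
        where
        s = eval Q (tr x)
        t = tr x
        N = k ^ₚ (q ∸ 2) *ₚ (L H ∘ₚ f)

theorem3p2 :
  ∀ {c₁ ℓ₁ c₂ ℓ₂} (p q n : ℕ) →
  Prime p → (∃ λ e → 1 ≤ e × q ≡ p ℕ.^ e) → 1 ≤ n →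
  (F : FiniteField c₁ ℓ₁ q) (K : FiniteField c₂ ℓ₂ (q ℕ.^ n)) →
  (ι : FiniteField.Carrier F → FiniteField.Carrier K) →
  let module F = FiniteField F
      module F[x] = Polynomial F.commutativeRing
      open Polynomial (FiniteField.commutativeRing K)
      open Extension q n F K ι
  in
  IsInclusion →
  (h : F[x].Poly) (f k : Poly) →
  MapsBaseToUnits k →
  let h[1] = F[x].eval h F.1#
      P    = f ∘ₚ Tr +ₚ (k ∘ₚ Tr) *ₚ L h
      Q    = T f +ₚ k *ₚ C (ι h[1]) *ₚ X
      xⁿ-1 = F[x].X F[x].^ₚ n F[x].-ₚ F[x].1ₚ
      E    = F[x].[Xⁿ-1]/[X-1] n
      P₀   = λ (G : Poly) (R H : F[x].Poly) →
               G ∘ₚ Tr +ₚ (k ∘ₚ embed R ∘ₚ Tr) ^ₚ (q ∸ 2) *ₚ L H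
      M    = λ (H : F[x].Poly) →
               (-ₚ (k ^ₚ (q ∸ 2) *ₚ (L H ∘ₚ f)))
               +ₚ X *ₚ C (ι ((F.1# F.- h[1] F.* F[x].eval H F.1#) F.* (n F.· F.1#) F.⁻¹))
  in
  (IsPermutationPolynomial P ⇔ (F[x].Coprimeₚ h E × PermutesBase Q))
  × (p ∣ n → F[x].Coprimeₚ h E ⇔ F[x].Coprimeₚ h xⁿ-1)
  × (IsPermutationPolynomial P →
      (p ∣ n →
        ∃! F[x]._≈ₚ_ (F[x].ReducedInverse h xⁿ-1 n)
        × (∀ R → InducesInverseOnBase R Q →
           ∀ H → F[x].ReducedInverse h xⁿ-1 n H →
           ∀ G → G ≅ -ₚ ((k ∘ₚ embed R) ^ₚ (q ∸ 2) *ₚ (L H ∘ₚ f ∘ₚ embed R))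
                   [modₚ X ^ₚ q -ₚ X ] →
           InducesInverse (P₀ G R H) P))
      × (p ∤ n →
        ∃! F[x]._≈ₚ_ (F[x].ReducedInverse h E (n ∸ 1))
        × (∀ R → InducesInverseOnBase R Q →
           ∀ H → F[x].ReducedInverse h E (n ∸ 1) H →
           ∀ G → G ≅ M H ∘ₚ embed R [modₚ X ^ₚ q -ₚ X ] →
           InducesInverse (P₀ G R H) P)))
theorem3p2 p q n p-prime (e , 1≤e , q≡p^e) 1≤n F K ι ι-inclusion h f k k-units =
    mk⇔ (λ P-bijective → permutation⇒coprime P-bijective , permutation⇒permutesBase P-bijective)
        (λ (coprime , permutes) → coprime∧permutesBase⇒permutation coprime permutes)
  , coprime-E⇔coprime-xⁿ-1
  , λ P-bijective →
      (λ p∣n → F.reducedInverse h monic-xⁿ-1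
                 (Equivalence.to (coprime-E⇔coprime-xⁿ-1 p∣n) (permutation⇒coprime P-bijective))
             , λ R R-inverse H reduced → inverse-p∣n R R-inverse H P-bijective reduced)
    , (λ p∤n → F.reducedInverse h monic-E (permutation⇒coprime P-bijective)
             , λ R R-inverse H reduced → inverse-p∤n R R-inverse H P-bijective p∤n reduced)
  where
  open PermutationCriterion p-prime 1≤e q≡p^e 1≤n F K ι ι-inclusion h f k k-units
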